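{- In the secretary setting of online pen testing, an $O(\log n)$-competitive algorithm exists in each of the following two cases: (1) the order is random and the player is given no information; (2) the order is arbitrary and the player is given optimum information. Here the $O(\log n)$ hides a universal constant: there is a universal $C>0$ such that for every integer $n\ge2$ in each of the two cases there is a $(C\log n)$-competitive player.
   Context: Online pen testing: an instance is given by values $X_1,\ldots,X_n \ge 0$, hidden from the player. At each step $i=1,2,\ldots,n$ in order, the player first picks a threshold $\theta_i \in [0,+\infty]$. If $X_i > \theta_i$ the test passes (and the player learns only that it passed); if $X_i \le \theta_i$ the test fails and the player observes $X_i$. The remaining utility of option $i$ becomes $X_i' = \max\{X_i-\theta_i,0\}$ (which is $0$ if $\theta_i=+\infty$). The player then irrevocably accepts or rejects option $i$; upon acceptance the game ends with score $X_i'$. If no option is ever accepted the score is $0$. The player knows $n$ and may be randomized: $\theta_i$ may depend on the information given in advance, on the outcomes of the previous tests and on internal randomness (independent of the arrival order), and the accept/reject decision may in addition depend on the outcome of test $i$. Secretary setting: there are numbers $a_1,\ldots,a_n\ge 0$, and $(X_1,\ldots,X_n)$ is a permutation of $(a_1,\ldots,a_n)$. In the random order case the permutation is uniformly random; in the arbitrary order case it is an arbitrary fixed permutation, unknown to the player. The information given to the player in advance is one of: full information (the player is given $a_1,\ldots,a_n$); optimum information (the player is given only $\max_i a_i$); no information (the player is given nothing about the $a_i$'s). A player (a fixed strategy taking the given information as input) is $\alpha$-competitive in the random order case if for all $a_1,\ldots,a_n\ge0$ its expected score, over the permutation and its own randomness, is at least $\frac1\alpha\max_i a_i$. It is $\alpha$-competitive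 in the arbitrary order case if for all $a_1,\ldots,a_n\ge0$ and every permutation $(X_i)$ of $(a_i)$ its expected score, over its own randomness, is at least $\frac1\alpha\max_i a_i$. -}

module Defs where

open import Algebra.Bundles using (CommutativeRing)
open import Algebra.Structures using (IsCommutativeRing)
open import Data.Bool.Base using (Bool; if_then_else_)
open import Data.List.Base using (List; []; _∷_; foldr; map; concatMap; length)
open import Data.List.Relation.Binary.Permutation.Propositional using (_↭_)
open import Data.List.Relation.Unary.All using (All)
open import Data.Nat.Base using (ℕ)
open import Data.Product.Base using (_×_; _,_; proj₁; proj₂)
open import Data.Unit.Base using (⊤; tt)
open import Level using (Level; suc; _⊔_)
open import Relation.Binary.Bundles using (DecTotalOrder)
open import Relation.Binary.Core using (Rel)
open import Relation.Binary.PropositionalEquality.Core using (_≡_; _≢_)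
open import Relation.Binary.Structures using (IsDecTotalOrder)
open import Relation.Nullary.Decidable.Core using (does)

import Algebra.Construct.NaturalChoice.Max as BinaryMax
import Algebra.Definitions.RawMonoid as RawMonoidDefinitions
import Data.List.Extrema as Extrema

-- Ordered fields; classically, the real numbers are an instance. Equality is
-- propositional, so that every Agda function on scalars (in particular every
-- strategy below) is automatically well defined on numbers. The order is
-- decidable because the game itself branches on the comparison X ≤ θ.
-- The inverse is total, with an unspecified value at 0#.
record OrderedField c ℓ : Set (suc (c ⊔ ℓ)) where
  infix  8 _⁻¹
  infix  8 -_
  infixl 7 _*_
  infixl 6 _+_ _-_
  infix  4 _≤_
  field
    Carrier           : Set c
    _≤_               : Rel Carrier ℓ
    _+_ _*_           : Carrier → Carrier → Carrier
    -_ _⁻¹            : Carrier → Carrier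
    0# 1#             : Carrier
    isCommutativeRing : IsCommutativeRing _≡_ _+_ _*_ -_ 0# 1#
    0≢1               : 0# ≢ 1#
    ⁻¹-inverseʳ       : ∀ {x} → x ≢ 0# → x * x ⁻¹ ≡ 1#
    isDecTotalOrder   : IsDecTotalOrder _≡_ _≤_
    +-monoˡ-≤         : ∀ z {x y} → x ≤ y → x + z ≤ y + z
    *-nonneg          : ∀ {x y} → 0# ≤ x → 0# ≤ y → 0# ≤ x * y

  commutativeRing : CommutativeRing c c
  commutativeRing = record { isCommutativeRing = isCommutativeRing }

  decTotalOrder : DecTotalOrder c c ℓ
  decTotalOrder = record { isDecTotalOrder = isDecTotalOrder }

  open DecTotalOrder decTotalOrder public using (totalOrder; _≤?_)

  _-_ : Carrier → Carrier → Carrier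
  x - y = x + - y

  fromℕ : ℕ → Carrier
  fromℕ n = n · 1#
    where
    open RawMonoidDefinitions (CommutativeRing.+-rawMonoid commutativeRing)
      renaming (_×_ to _·_)

module _ {a} {A : Set a} where

  insertions : A → List A → List (List A)
  insertions x []       = (x ∷ []) ∷ []
  insertions x (y ∷ ys) = (x ∷ y ∷ ys) ∷ map (y ∷_) (insertions x ys)

  -- All (length xs)! rearrangements, one per permutation of the positions;
  -- entries of xs that happen to be equal are treated as distinguishable.
  permutations : List A → List (List A)
  permutations []       = [] ∷ []
  permutations (x ∷ xs) = concatMap (insertions x) (permutations xs)

module PenTesting {c ℓ : Level} (𝔽 : OrderedField c ℓ) where

  open OrderedField 𝔽
  open BinaryMax totalOrder using () renaming (_⊔_ to _max_)

  sum : List Carrier → Carrier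
  sum = foldr _+_ 0#

  -- The default value 0# is immaterial for non-empty lists of non-negative
  -- numbers.
  maximum : List Carrier → Carrier
  maximum = Extrema.max totalOrder 0#

  data Threshold : Set (c ⊔ ℓ) where
    finite : (θ : Carrier) → 0# ≤ θ → Threshold
    ∞      : Threshold

  data Outcome : Set c where
    passed : Outcome
    failed : (observed : Carrier) → Outcome

  test : Carrier → Threshold → Outcome
  test x (finite θ _) = if does (x ≤? θ) then failed x else passed
  test x ∞            = failed x

  remaining : Carrier → Threshold → Carrier
  remaining x (finite θ _) = (x - θ) max 0#
  remaining x ∞            = 0#

  -- A strategy with its advance information and randomness already fixed.
  -- Histories list the outcomes of the previous tests, most recent first;
  -- their length tells the current step.
  record Strategy : Set (c ⊔ ℓ) where
    field
      threshold : (history : List Outcome) → Threshold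
      accept    : (history : List Outcome) (current : Outcome) → Bool

  scoreFrom : Strategy → List Outcome → List Carrier → Carrier
  scoreFrom s history []       = 0#
  scoreFrom s history (x ∷ xs) =
    if accept history o then remaining x θ else scoreFrom s (o ∷ history) xs
    where
    open Strategy s
    θ = threshold history
    o = test x θ

  score : Strategy → List Carrier → Carrier
  score s = scoreFrom s []

  -- A randomized player receiving advance information of type I: a random
  -- seed, drawn once and for all from a finitely supported distribution, is
  -- available at every step.
  record Player {i} (I : Set i) : Set (suc Level.zero ⊔ c ⊔ ℓ ⊔ i) where
    field
      Seed           : Set
      distribution   : List (Carrier × Seed)
      weights-nonneg : All (λ p → 0# ≤ proj₁ p) distribution
      weights-sum    : sum (map proj₁ distribution) ≡ 1#
      strategy       : I → Seed → Strategy

  expectedScore : ∀ {i} {I : Set i} → Player I → I → List Carrier → Carrier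
  expectedScore p info X =
    sum (map (λ (w , s) → w * score (strategy info s) X) distribution)
    where open Player p

  average : ∀ {a} {A : Set a} → (A → Carrier) → List A → Carrier
  average f xs = fromℕ (length xs) ⁻¹ * sum (map f xs)

  noInformation : List Carrier → ⊤
  noInformation _ = tt

  optimumInformation : List Carrier → Carrier
  optimumInformation = maximum

  module _ {i} {I : Set i} (information : List Carrier → I) (n : ℕ) where

    RandomOrderCompetitive : Carrier → Player I → Set (c ⊔ ℓ)
    RandomOrderCompetitive α p =
      (a : List Carrier) → length a ≡ n → All (0# ≤_) a →
      α ⁻¹ * maximum a ≤ average (expectedScore p (information a)) (permutations a)

    ArbitraryOrderCompetitive : Carrier → Player I → Set (c ⊔ ℓ)
    ArbitraryOrderCompetitive α p =
      (a : List Carrier) → length a ≡ n → All (0# ≤_) a →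
      (X : List Carrier) → X ↭ a →
      α ⁻¹ * maximum a ≤ expectedScore p (information a) X

{-# OPTIONS --safe #-}

-- Put L = ⌊log₂ n⌋, let M be the known maximum and split [0, M] into L + 2
-- steps of length 2τ. At every time draw an independent threshold, the j-th
-- grid point (0 ≤ j ≤ L) with probability 2^j / 2^(L+2) and otherwise ∞, and
-- accept the first option that passes. The levels are geometric, so an option
-- which passes some level leaves a gain of 2τ at the level below with half the
-- probability: up to an additive loss of at most 1 / 2^(L+2) per round, every
-- loss of survival probability is paid for by expected gain at rate τ. Since
-- meeting the maximal option alive is worth τ, the expected score is at least
-- τ (1 - n / 2^(L+2)) ≥ τ / 2.
--
-- In random order, observe the first ⌊n/2⌋ options with threshold ∞ and let b
-- be the largest of them. Then toss a fair coin between the strategy above run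
-- with b in place of M and the constant threshold b. With probability at least
-- 1/4 the second largest value b is in the first half and the largest value m
-- in the second half; the two branches then earn Ω(b / log n) and m - b.
module Submission where

open import Defs
open import Algebra.Bundles using (CommutativeRing)
open import Data.Bool.Base using (Bool; true; false; if_then_else_)
open import Data.List.Base using (List; []; _∷_; [_]; _++_; _ʳ++_; map; concatMap; length; take; drop)
open import Data.List.Membership.Propositional using (_∈_; lose)
open import Data.List.Membership.Propositional.Properties using (∈-∃++; ∈-insert; ∈-concatMap⁺; ∈-length)
open import Data.List.Properties using
  ( map-∘; map-cong; map-id; map-ʳ++; take++drop≡id; ++-assoc; ++-identityʳ
  ; length-++; length-ʳ++; length-map; length-take; length-drop)
open import Data.List.Relation.Binary.Permutation.Propositional as ↭ using
  (_↭_; prep; swap; ↭-refl; ↭-sym; ↭-trans; ↭-reflexive)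
open import Data.List.Relation.Binary.Permutation.Propositional.Properties using
  (↭-length; All-resp-↭; ∈-resp-↭; drop-mid; ↭-reverse)
open import Data.List.Relation.Unary.All as All using (All; []; _∷_)
open import Data.List.Relation.Unary.Any using (Any; here; there)
open import Data.Maybe.Base using (Maybe; just; nothing)
open import Data.Nat.Base as ℕ using (ℕ; zero; suc; z≤n; s≤s; ⌊_/2⌋; ⌈_/2⌉)
open import Data.Nat.Logarithm using (⌊log₂_⌋; ⌊log₂⌋-mono-≤; ⌊log₂[2^n]⌋≡n)
open import Data.Nat.Solver using (module +-*-Solver)
open import Data.Product.Base using (Σ; ∃; ∃₂; _×_; _,_; proj₁; proj₂)
open import Data.Sum.Base using (_⊎_; inj₁; inj₂)
open import Data.Unit.Base using (⊤; tt)
open import Function.Base using (_∘_)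
open import Level using (_⊔_)
open import Relation.Binary.Bundles using (DecTotalOrder)
open import Relation.Binary.PropositionalEquality using
  (_≡_; _≢_; refl; sym; trans; cong; cong₂; subst; subst₂; module ≡-Reasoning)
open import Relation.Nullary using (yes; no; contradiction)
open import Relation.Nullary.Decidable using (does; dec-true; dec-false)

import Algebra.Construct.NaturalChoice.Max as BinaryMax
import Algebra.Properties.Ring
import Algebra.Properties.Semiring.Mult
import Algebra.Solver.Ring.NaturalCoefficients.Default
import Data.List.Extrema as Extrema
import Data.List.Relation.Unary.All.Properties as All
import Data.Nat.Properties as ℕ
import Relation.Binary.Reasoning.PartialOrder

-- Arithmetic in ordered fields.

module OrderedFieldProperties {c ℓ} (𝔽 : OrderedField c ℓ) where

  open OrderedField 𝔽
  open CommutativeRing commutativeRing public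
    using (+-assoc; +-comm; +-identityˡ; +-identityʳ; -‿inverseˡ; -‿inverseʳ;
           *-assoc; *-comm; *-identityˡ; *-identityʳ; zeroˡ; zeroʳ; distribˡ; distribʳ;
           commutativeSemiring; semiring; ring)
  open DecTotalOrder decTotalOrder public
    using (poset; total; antisym) renaming (refl to ≤-refl; trans to ≤-trans; reflexive to ≤-reflexive)
  open Algebra.Properties.Ring ring using (-‿distribˡ-*; -‿involutive)
  open Algebra.Properties.Semiring.Mult semiring using (×-homo-+; ×1-homo-*)
  module Solver = Algebra.Solver.Ring.NaturalCoefficients.Default commutativeSemiring
  module ≤-Reasoning = Relation.Binary.Reasoning.PartialOrder poset
  open ≤-Reasoning

  +-monoʳ-≤ : ∀ z {x y} → x ≤ y → z + x ≤ z + y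
  +-monoʳ-≤ z {x} {y} x≤y = subst₂ _≤_ (+-comm x z) (+-comm y z) (+-monoˡ-≤ z x≤y)

  +-mono-≤ : ∀ {x y u v} → x ≤ y → u ≤ v → x + u ≤ y + v
  +-mono-≤ {y = y} {u = u} x≤y u≤v = ≤-trans (+-monoˡ-≤ u x≤y) (+-monoʳ-≤ y u≤v)

  x-y+y≡x : ∀ x y → (x - y) + y ≡ x
  x-y+y≡x x y = trans (+-assoc x (- y) y) (trans (cong (x +_) (-‿inverseˡ y)) (+-identityʳ x))

  x+y-y≡x : ∀ x y → (x + y) - y ≡ x
  x+y-y≡x x y = trans (+-assoc x y (- y)) (trans (cong (x +_) (-‿inverseʳ y)) (+-identityʳ x))

  +-cancelʳ-≤ : ∀ z {x y} → x + z ≤ y + z → x ≤ y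
  +-cancelʳ-≤ z {x} {y} x+z≤y+z = subst₂ _≤_ (x+y-y≡x x z) (x+y-y≡x y z) (+-monoˡ-≤ (- z) x+z≤y+z)

  +-cancelˡ-≤ : ∀ z {x y} → z + x ≤ z + y → x ≤ y
  +-cancelˡ-≤ z {x} {y} z+x≤z+y = +-cancelʳ-≤ z (subst₂ _≤_ (+-comm z x) (+-comm z y) z+x≤z+y)

  x≤x+y : ∀ {x y} → 0# ≤ y → x ≤ x + y
  x≤x+y {x} 0≤y = subst (_≤ x + _) (+-identityʳ x) (+-monoʳ-≤ x 0≤y)

  x≤y+x : ∀ {x y} → 0# ≤ y → x ≤ y + x
  x≤y+x {x} {y} 0≤y = subst (x ≤_) (+-comm x y) (x≤x+y 0≤y)

  +-nonneg : ∀ {x y} → 0# ≤ x → 0# ≤ y → 0# ≤ x + y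
  +-nonneg 0≤x 0≤y = ≤-trans 0≤x (x≤x+y 0≤y)

  x≤y⇒0≤y-x : ∀ {x y} → x ≤ y → 0# ≤ y - x
  x≤y⇒0≤y-x {x} x≤y = subst (_≤ _) (-‿inverseʳ x) (+-monoˡ-≤ (- x) x≤y)

  *-monoʳ-≤ : ∀ {z x y} → 0# ≤ z → x ≤ y → z * x ≤ z * y
  *-monoʳ-≤ {z} {x} {y} 0≤z x≤y = begin
    z * x                  ≤⟨ x≤y+x (*-nonneg 0≤z (x≤y⇒0≤y-x x≤y)) ⟩
    z * (y - x) + z * x    ≡⟨ distribˡ z (y - x) x ⟨
    z * ((y - x) + x)      ≡⟨ cong (z *_) (x-y+y≡x y x) ⟩
    z * y                  ∎

  *-monoˡ-≤ : ∀ {z x y} → 0# ≤ z → x ≤ y → x * z ≤ y * z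
  *-monoˡ-≤ {z} {x} {y} 0≤z x≤y = subst₂ _≤_ (*-comm z x) (*-comm z y) (*-monoʳ-≤ 0≤z x≤y)

  0≤1 : 0# ≤ 1#
  0≤1 with total 0# 1#
  ... | inj₁ 0≤1 = 0≤1
  ... | inj₂ 1≤0 = subst (0# ≤_) -1*-1≡1 (*-nonneg 0≤-1 0≤-1)
    where
    0≤-1 : 0# ≤ - 1#
    0≤-1 = subst (0# ≤_) (+-identityˡ (- 1#)) (x≤y⇒0≤y-x 1≤0)
    -1*-1≡1 : - 1# * - 1# ≡ 1#
    -1*-1≡1 = trans (sym (-‿distribˡ-* 1# (- 1#)))
             (trans (cong -_ (*-identityˡ (- 1#))) (-‿involutive 1#))

  fromℕ-nonneg : ∀ n → 0# ≤ fromℕ n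
  fromℕ-nonneg zero    = ≤-refl
  fromℕ-nonneg (suc n) = +-nonneg 0≤1 (fromℕ-nonneg n)

  fromℕ-+ : ∀ m n → fromℕ (m ℕ.+ n) ≡ fromℕ m + fromℕ n
  fromℕ-+ = ×-homo-+ 1#

  fromℕ-* : ∀ m n → fromℕ (m ℕ.* n) ≡ fromℕ m * fromℕ n
  fromℕ-* = ×1-homo-*

  fromℕ-suc-* : ∀ n z → fromℕ (suc n) * z ≡ z + fromℕ n * z
  fromℕ-suc-* n z = trans (distribʳ z 1# (fromℕ n)) (cong (_+ fromℕ n * z) (*-identityˡ z))

  fromℕ-mono-≤ : ∀ {m n} → m ℕ.≤ n → fromℕ m ≤ fromℕ n
  fromℕ-mono-≤ {n = n} ℕ.z≤n   = fromℕ-nonneg n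
  fromℕ-mono-≤ (ℕ.s≤s m≤n) = +-monoʳ-≤ 1# (fromℕ-mono-≤ m≤n)

  fromℕ≢0 : ∀ {n} → 0 ℕ.< n → fromℕ n ≢ 0#
  fromℕ≢0 {n} 0<n n≡0 = 0≢1 (antisym 0≤1 (begin
    1#        ≡⟨ +-identityʳ 1# ⟨
    fromℕ 1   ≤⟨ fromℕ-mono-≤ 0<n ⟩
    fromℕ n   ≡⟨ n≡0 ⟩
    0#        ∎))

  ⁻¹-nonneg : ∀ {x} → 0# ≤ x → x ≢ 0# → 0# ≤ x ⁻¹
  ⁻¹-nonneg {x} 0≤x x≢0 with total 0# (x ⁻¹)
  ... | inj₁ 0≤x⁻¹ = 0≤x⁻¹
  ... | inj₂ x⁻¹≤0 = contradiction (antisym 0≤1 (begin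
    1#         ≡⟨ ⁻¹-inverseʳ x≢0 ⟨
    x * x ⁻¹   ≤⟨ *-monoʳ-≤ 0≤x x⁻¹≤0 ⟩
    x * 0#     ≡⟨ zeroʳ x ⟩
    0#         ∎)) 0≢1

  x≤z*y⇒z⁻¹*x≤y : ∀ {x y z} → 0# ≤ z → z ≢ 0# → x ≤ z * y → z ⁻¹ * x ≤ y
  x≤z*y⇒z⁻¹*x≤y {x} {y} {z} 0≤z z≢0 x≤z*y = begin
    z ⁻¹ * x         ≤⟨ *-monoʳ-≤ (⁻¹-nonneg 0≤z z≢0) x≤z*y ⟩
    z ⁻¹ * (z * y)   ≡⟨ *-assoc (z ⁻¹) z y ⟨
    (z ⁻¹ * z) * y   ≡⟨ cong (_* y) (trans (*-comm (z ⁻¹) z) (⁻¹-inverseʳ z≢0)) ⟩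
    1# * y           ≡⟨ *-identityˡ y ⟩
    y                ∎

  z*x≤y⇒x≤z⁻¹*y : ∀ {x y z} → 0# ≤ z → z ≢ 0# → z * x ≤ y → x ≤ z ⁻¹ * y
  z*x≤y⇒x≤z⁻¹*y {x} {y} {z} 0≤z z≢0 z*x≤y = begin
    x                ≡⟨ *-identityˡ x ⟨
    1# * x           ≡⟨ cong (_* x) (trans (*-comm (z ⁻¹) z) (⁻¹-inverseʳ z≢0)) ⟨
    (z ⁻¹ * z) * x   ≡⟨ *-assoc (z ⁻¹) z x ⟩
    z ⁻¹ * (z * x)   ≤⟨ *-monoʳ-≤ (⁻¹-nonneg 0≤z z≢0) z*x≤y ⟩
    z ⁻¹ * y         ∎

-- Enumeration of the permutations of a list.

module _ {a} {A : Set a} where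

  insertions-↭ : ∀ (x : A) ys → All (_↭ x ∷ ys) (insertions x ys)
  insertions-↭ x []       = ↭-refl ∷ []
  insertions-↭ x (y ∷ ys) = ↭-refl ∷
    All.map⁺ (All.map (λ q↭ → ↭-trans (prep y q↭) (swap y x ↭-refl)) (insertions-↭ x ys))

  permutations-↭ : ∀ (xs : List A) → All (_↭ xs) (permutations xs)
  permutations-↭ []       = ↭-refl ∷ []
  permutations-↭ (x ∷ xs) = All.concat⁺ (All.map⁺
    (All.map (λ {p} p↭ → All.map (λ q↭ → ↭-trans q↭ (prep x p↭)) (insertions-↭ x p))
             (permutations-↭ xs)))

  ∈-insertions : ∀ (x : A) ys → x ∷ ys ∈ insertions x ys
  ∈-insertions x []       = here refl
  ∈-insertions x (y ∷ ys) = here refl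

  -- Makes the list of permutations non-empty, so that an average over it divides by a nonzero
  -- number.
  ∈-permutations : ∀ (xs : List A) → xs ∈ permutations xs
  ∈-permutations []       = here refl
  ∈-permutations (x ∷ xs) = ∈-concatMap⁺ (insertions x) (lose (∈-permutations xs) (∈-insertions x xs))

  drop-length-++ : ∀ (xs ys : List A) → drop (length xs) (xs ++ ys) ≡ ys
  drop-length-++ []       ys = refl
  drop-length-++ (x ∷ xs) ys = drop-length-++ xs ys

-- Finite sums.

module Sums {c ℓ} (𝔽 : OrderedField c ℓ) where

  open OrderedField 𝔽
  open PenTesting 𝔽
  open OrderedFieldProperties 𝔽

  module _ {a} {A : Set a} where

    sum-++ : ∀ (f : A → Carrier) xs ys → sum (map f (xs ++ ys)) ≡ sum (map f xs) + sum (map f ys)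
    sum-++ f []       ys = sym (+-identityˡ _)
    sum-++ f (x ∷ xs) ys = trans (cong (f x +_) (sum-++ f xs ys)) (sym (+-assoc (f x) _ _))

    sum-+ : ∀ (f g : A → Carrier) xs →
            sum (map (λ x → f x + g x) xs) ≡ sum (map f xs) + sum (map g xs)
    sum-+ f g []       = sym (+-identityˡ 0#)
    sum-+ f g (x ∷ xs) = trans (cong (f x + g x +_) (sum-+ f g xs))
      (solve 4 (λ a b c d → (a :+ b) :+ (c :+ d) := (a :+ c) :+ (b :+ d)) refl (f x) (g x) _ _)
      where open Solver

    sum-*ˡ : ∀ z (f : A → Carrier) xs → sum (map (λ x → z * f x) xs) ≡ z * sum (map f xs)
    sum-*ˡ z f []       = sym (zeroʳ z)
    sum-*ˡ z f (x ∷ xs) = trans (cong (z * f x +_) (sum-*ˡ z f xs)) (sym (distribˡ z (f x) _))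

    sum-*ʳ : ∀ z (f : A → Carrier) xs → sum (map (λ x → f x * z) xs) ≡ sum (map f xs) * z
    sum-*ʳ z f xs = trans (cong sum (map-cong (λ x → *-comm (f x) z) xs))
                   (trans (sum-*ˡ z f xs) (*-comm z _))

    sum-mono : ∀ {f g : A → Carrier} {xs} → All (λ x → f x ≤ g x) xs → sum (map f xs) ≤ sum (map g xs)
    sum-mono []             = ≤-refl
    sum-mono (fx≤gx ∷ f≤g) = +-mono-≤ fx≤gx (sum-mono f≤g)

    sum-nonneg : ∀ {f : A → Carrier} {xs} → All (λ x → 0# ≤ f x) xs → 0# ≤ sum (map f xs)
    sum-nonneg []           = ≤-refl
    sum-nonneg (0≤fx ∷ 0≤f) = +-nonneg 0≤fx (sum-nonneg 0≤f)

    sum-const-1 : ∀ (xs : List A) → sum (map (λ _ → 1#) xs) ≡ fromℕ (length xs)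
    sum-const-1 []       = refl
    sum-const-1 (x ∷ xs) = cong (1# +_) (sum-const-1 xs)

    sum-concatMap : ∀ {b} {B : Set b} (f : A → Carrier) (g : B → List A) xs →
                    sum (map f (concatMap g xs)) ≡ sum (map (λ x → sum (map f (g x))) xs)
    sum-concatMap f g []       = refl
    sum-concatMap f g (x ∷ xs) =
      trans (sum-++ f (g x) (concatMap g xs)) (cong (sum (map f (g x)) +_) (sum-concatMap f g xs))

    sum-cong : ∀ {f g : A → Carrier} (xs : List A) → (∀ x → f x ≡ g x) → sum (map f xs) ≡ sum (map g xs)
    sum-cong xs f≗g = cong sum (map-cong f≗g xs)

  -- Sums over insertions and over permutations.

  module _ {a} {A : Set a} where

    sumInsertions : (List A → Carrier) → A → List A → Carrier
    sumInsertions f x ys = sum (map f (insertions x ys))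

    sumPermutations : (List A → Carrier) → List A → Carrier
    sumPermutations f xs = sum (map f (permutations xs))

    sumInsertions-∷ : ∀ f x y ys →
      sumInsertions f x (y ∷ ys) ≡ f (x ∷ y ∷ ys) + sumInsertions (f ∘ (y ∷_)) x ys
    sumInsertions-∷ f x y ys = cong (λ zs → f (x ∷ y ∷ ys) + sum zs) (sym (map-∘ (insertions x ys)))

    -- A uniform permutation arises from one of the tail by a uniform insertion of the head; the
    -- counting arguments below peel off single entries in this way.
    sumPermutations-∷ : ∀ f x xs → sumPermutations f (x ∷ xs) ≡ sumPermutations (sumInsertions f x) xs
    sumPermutations-∷ f x xs = sum-concatMap f (insertions x) (permutations xs)

    private
      -- Sorts the double insertions by which of `x` and `y` come before `z`: both (in two orders),
      -- only `y`, only `x`, or neither.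
      sumInsertions₂-∷ : ∀ f x y z zs →
        sumInsertions (sumInsertions f x) y (z ∷ zs) ≡
        (f (x ∷ y ∷ z ∷ zs) + (f (y ∷ x ∷ z ∷ zs) + sumInsertions (f ∘ (y ∷_) ∘ (z ∷_)) x zs))
        + (sumInsertions (f ∘ (x ∷_) ∘ (z ∷_)) y zs
           + sumInsertions (sumInsertions (f ∘ (z ∷_)) x) y zs)
      sumInsertions₂-∷ f x y z zs = begin
        sumInsertions (sumInsertions f x) y (z ∷ zs)
          ≡⟨ sumInsertions-∷ (sumInsertions f x) y z zs ⟩
        sumInsertions f x (y ∷ z ∷ zs) + sumInsertions (sumInsertions f x ∘ (z ∷_)) y zs
          ≡⟨ cong₂ _+_
               (trans (sumInsertions-∷ f x y (z ∷ zs))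
                        (cong (f (x ∷ y ∷ z ∷ zs) +_) (sumInsertions-∷ (f ∘ (y ∷_)) x z zs)))
               (trans (sum-cong (insertions y zs) (sumInsertions-∷ f x z))
                        (sum-+ _ _ (insertions y zs))) ⟩
        _ ∎
        where open ≡-Reasoning

    -- The two orders of insertion produce the same lists with the same multiplicities. In the
    -- classification by position relative to `z`, exchanging `x` and `y` only permutes the first
    -- four summands; the fifth is the induction hypothesis.
    sumInsertions-swap : ∀ f x y zs →
      sumInsertions (sumInsertions f x) y zs ≡ sumInsertions (sumInsertions f y) x zs
    sumInsertions-swap f x y [] =
      solve 2 (λ u v → (u :+ (v :+ con 0)) :+ con 0 := (v :+ (u :+ con 0)) :+ con 0) refl _ _
      where open Solver
    sumInsertions-swap f x y (z ∷ zs) = begin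
      sumInsertions (sumInsertions f x) y (z ∷ zs)  ≡⟨ sumInsertions₂-∷ f x y z zs ⟩
      (fxy + (fyx + sx)) + (sy + sumInsertions (sumInsertions (f ∘ (z ∷_)) x) y zs)
         ≡⟨ cong (λ t → (fxy + (fyx + sx)) + (sy + t)) (sumInsertions-swap (f ∘ (z ∷_)) x y zs) ⟩
      (fxy + (fyx + sx)) + (sy + sumInsertions (sumInsertions (f ∘ (z ∷_)) y) x zs)
         ≡⟨ solve 5 (λ u v s t w → (u :+ (v :+ s)) :+ (t :+ w) := (v :+ (u :+ t)) :+ (s :+ w)) refl fxy fyx sx sy _ ⟩
      (fyx + (fxy + sy)) + (sx + sumInsertions (sumInsertions (f ∘ (z ∷_)) y) x zs)
         ≡⟨ sumInsertions₂-∷ f y x z zs ⟨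
      sumInsertions (sumInsertions f y) x (z ∷ zs)  ∎
      where
      open ≡-Reasoning
      open Solver using (solve; _:+_; _:=_)
      fxy = f (x ∷ y ∷ z ∷ zs)
      fyx = f (y ∷ x ∷ z ∷ zs)
      sx  = sumInsertions (f ∘ (y ∷_) ∘ (z ∷_)) x zs
      sy  = sumInsertions (f ∘ (x ∷_) ∘ (z ∷_)) y zs

    -- Allows the two largest entries to be moved to the front of the list, where the enumeration
    -- inserts them last.
    sumPermutations-resp-↭ : ∀ f {xs ys} → xs ↭ ys → sumPermutations f xs ≡ sumPermutations f ys
    sumPermutations-resp-↭ f ↭.refl = refl
    sumPermutations-resp-↭ f (↭.trans xs↭ys ys↭zs) =
      trans (sumPermutations-resp-↭ f xs↭ys) (sumPermutations-resp-↭ f ys↭zs)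
    sumPermutations-resp-↭ f {x ∷ xs} {_ ∷ ys} (prep _ xs↭ys) = begin
      sumPermutations f (x ∷ xs)               ≡⟨ sumPermutations-∷ f x xs ⟩
      sumPermutations (sumInsertions f x) xs   ≡⟨ sumPermutations-resp-↭ _ xs↭ys ⟩
      sumPermutations (sumInsertions f x) ys   ≡⟨ sumPermutations-∷ f x ys ⟨
      sumPermutations f (x ∷ ys)               ∎
      where open ≡-Reasoning
    sumPermutations-resp-↭ f {x ∷ y ∷ xs} {_ ∷ _ ∷ ys} (swap _ _ xs↭ys) = begin
      sumPermutations f (x ∷ y ∷ xs)
        ≡⟨ trans (sumPermutations-∷ f x (y ∷ xs)) (sumPermutations-∷ _ y xs) ⟩
      sumPermutations (sumInsertions (sumInsertions f x) y) xs
        ≡⟨ sumPermutations-resp-↭ _ xs↭ys ⟩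
      sumPermutations (sumInsertions (sumInsertions f x) y) ys
        ≡⟨ sum-cong (permutations ys) (sumInsertions-swap f x y) ⟩
      sumPermutations (sumInsertions (sumInsertions f y) x) ys
        ≡⟨ trans (sumPermutations-∷ f y (x ∷ ys)) (sumPermutations-∷ _ x ys) ⟨
      sumPermutations f (y ∷ x ∷ ys)
        ∎
      where open ≡-Reasoning

    sumInsertions-1 : ∀ x ys → sumInsertions (λ _ → 1#) x ys ≡ fromℕ (suc (length ys))
    sumInsertions-1 x ys = trans (sum-const-1 (insertions x ys)) (cong fromℕ (length-insertions ys))
      where
      length-insertions : ∀ ys → length (insertions x ys) ≡ suc (length ys)
      length-insertions []       = refl
      length-insertions (y ∷ ys) = cong suc
        (trans (length-map (y ∷_) (insertions x ys)) (length-insertions ys))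

    -- The first `h` insertion positions place `x` among the first `h` entries; the terms of the
    -- other positions are nonnegative and dropped.
    sumInsertions-early : ∀ h x ys {f B} → h ℕ.≤ suc (length ys) → (∀ q → 0# ≤ f q) →
      (∀ q → q ↭ x ∷ ys → x ∈ take h q → B ≤ f q) →
      fromℕ h * B ≤ sumInsertions f x ys
    sumInsertions-early zero x ys {f} {B} _ 0≤f _ =
      subst (_≤ _) (sym (zeroˡ B)) (sum-nonneg (All.universal 0≤f (insertions x ys)))
    sumInsertions-early (suc zero) x [] {f} {B} _ 0≤f B≤f =
      subst (_≤ _) (sym (fromℕ-suc-* 0 B))
        (+-mono-≤ (B≤f _ ↭-refl (here refl)) (≤-reflexive (zeroˡ B)))
    sumInsertions-early (suc (suc h)) x [] (s≤s ())
    sumInsertions-early (suc h) x (y ∷ ys) {f} {B} (s≤s h≤) 0≤f B≤f =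
      subst₂ _≤_ (sym (fromℕ-suc-* h B)) (sym (sumInsertions-∷ f x y ys))
        (+-mono-≤ (B≤f _ ↭-refl (here refl))
          (sumInsertions-early h x ys h≤ (0≤f ∘ (y ∷_))
            (λ q q↭ x∈ → B≤f (y ∷ q) (↭-trans (prep y q↭) (swap y x ↭-refl)) (there x∈))))

    -- Insertions behind the first `h` entries leave those entries as they were. The hypothesis on
    -- `f` records this, so that an entry already placed early stays early when the second one is
    -- inserted.
    sumInsertions-late : ∀ h x ys {f B} → (∀ q → 0# ≤ f q) →
      (∀ q → q ↭ x ∷ ys → take h q ≡ take h ys → x ∈ drop h q → B ≤ f q) →
      fromℕ (suc (length ys) ℕ.∸ h) * B ≤ sumInsertions f x ys
    sumInsertions-late zero x [] {f} {B} 0≤f B≤f =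
      subst (_≤ _) (sym (fromℕ-suc-* 0 B))
        (+-mono-≤ (B≤f _ ↭-refl refl (here refl)) (≤-reflexive (zeroˡ B)))
    sumInsertions-late zero x (y ∷ ys) {f} {B} 0≤f B≤f =
      subst₂ _≤_ (sym (fromℕ-suc-* (suc (length ys)) B)) (sym (sumInsertions-∷ f x y ys))
        (+-mono-≤ (B≤f _ ↭-refl refl (here refl))
          (sumInsertions-late zero x ys (0≤f ∘ (y ∷_))
            (λ q q↭ _ x∈ → B≤f (y ∷ q) (↭-trans (prep y q↭) (swap y x ↭-refl)) refl (there x∈))))
    sumInsertions-late (suc h) x [] {f} {B} 0≤f B≤f =
      subst (_≤ _) (sym (trans (cong (λ k → fromℕ k * B) (ℕ.0∸n≡0 h)) (zeroˡ B)))
        (sum-nonneg (All.universal 0≤f (insertions x [])))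
    sumInsertions-late (suc h) x (y ∷ ys) {f} {B} 0≤f B≤f =
      ≤-trans
          (sumInsertions-late h x ys (0≤f ∘ (y ∷_))
            (λ q q↭ q≡ x∈ → B≤f (y ∷ q) (↭-trans (prep y q↭) (swap y x ↭-refl)) (cong (y ∷_) q≡) x∈))
          (≤-trans (x≤y+x (0≤f _)) (≤-reflexive (sym (sumInsertions-∷ f x y ys))))

    -- In the random order b falls among the first h entries and m among the
    -- others in h (n − h) of the n (n − 1) pairs of positions.
    average-splitPair : ∀ {f : List A → Carrier} {B} k h m b r → (∀ q → 0# ≤ f q) → 0# ≤ B →
      h ℕ.≤ suc (length r) →
      suc (suc (length r)) ℕ.* suc (length r) ℕ.≤ k ℕ.* (h ℕ.* (suc (suc (length r)) ℕ.∸ h)) →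
      (∀ q → q ↭ m ∷ b ∷ r → b ∈ take h q → m ∈ drop h q → B ≤ f q) →
      fromℕ (length (permutations (m ∷ b ∷ r))) * B ≤ fromℕ k * sumPermutations f (m ∷ b ∷ r)
    average-splitPair {f} {B} k h m b r 0≤f 0≤B h≤ pairs≤ B≤f = begin
      fromℕ (length (permutations (m ∷ b ∷ r))) * B
        ≡⟨ cong (_* B) (sum-const-1 (permutations (m ∷ b ∷ r))) ⟨
      sumPermutations (λ _ → 1#) (m ∷ b ∷ r) * B
        ≡⟨ cong (_* B) (unfold₂ (λ _ → 1#)) ⟩
      sumPermutations (sumInsertions (sumInsertions (λ _ → 1#) m) b) r * B
        ≡⟨ sum-*ʳ B _ (permutations r) ⟨
      sumPermutations (λ p → sumInsertions (sumInsertions (λ _ → 1#) m) b p * B) r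
        ≤⟨ sum-mono (All.map (λ {p} → pointwise p) (permutations-↭ r)) ⟩
      sumPermutations (λ p → κ * sumInsertions (sumInsertions f m) b p) r
        ≡⟨ sum-*ˡ κ _ (permutations r) ⟩
      κ * sumPermutations (sumInsertions (sumInsertions f m) b) r
        ≡⟨ cong (κ *_) (unfold₂ f) ⟨
      κ * sumPermutations f (m ∷ b ∷ r)
        ∎
      where
      open ≤-Reasoning

      n-1 = suc (length r)
      n   = suc n-1

      κ   = fromℕ k

      unfold₂ : ∀ g → sumPermutations g (m ∷ b ∷ r) ≡ sumPermutations (sumInsertions (sumInsertions g m) b) r
      unfold₂ g = trans (sumPermutations-∷ g m (b ∷ r)) (sumPermutations-∷ _ b r)

      pairs : ∀ p → p ↭ r → sumInsertions (sumInsertions (λ _ → 1#) m) b p ≤ fromℕ (n ℕ.* n-1)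
      pairs p p↭r = begin
        sumInsertions (sumInsertions (λ _ → 1#) m) b p
          ≤⟨ sum-mono (All.map (λ {q} q↭ → ≤-reflexive
               (trans (sumInsertions-1 m q)
                        (trans (cong fromℕ (cong suc (trans (↭-length q↭) (cong suc (↭-length p↭r)))))
                                 (sym (*-identityʳ (fromℕ n))))))
               (insertions-↭ b p)) ⟩
        sumInsertions (λ _ → fromℕ n * 1#) b p
          ≡⟨ sum-*ˡ (fromℕ n) (λ _ → 1#) (insertions b p) ⟩
        fromℕ n * sumInsertions (λ _ → 1#) b p
          ≡⟨ cong (fromℕ n *_) (trans (sumInsertions-1 b p) (cong (fromℕ ∘ suc) (↭-length p↭r))) ⟩
        fromℕ n * fromℕ n-1
          ≡⟨ fromℕ-* n n-1 ⟨
        fromℕ (n ℕ.* n-1)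
          ∎

      late : ∀ p → p ↭ r → ∀ q → q ↭ b ∷ p → b ∈ take h q →
             fromℕ (n ℕ.∸ h) * B ≤ sumInsertions f m q
      late p p↭r q q↭ b∈ = subst (λ k → fromℕ (suc k ℕ.∸ h) * B ≤ sumInsertions f m q)
        (trans (↭-length q↭) (cong suc (↭-length p↭r)))
        (sumInsertions-late h m q 0≤f
          (λ s s↭ s≡ m∈ → B≤f s (↭-trans s↭ (prep m (↭-trans q↭ (prep b p↭r))))
                              (subst (b ∈_) (sym s≡) b∈) m∈))

      pointwise : ∀ p → p ↭ r →
        sumInsertions (sumInsertions (λ _ → 1#) m) b p * B ≤ κ * sumInsertions (sumInsertions f m) b p
      pointwise p p↭r = begin
        sumInsertions (sumInsertions (λ _ → 1#) m) b p * B
          ≤⟨ *-monoˡ-≤ 0≤B (≤-trans (pairs p p↭r) (fromℕ-mono-≤ pairs≤)) ⟩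
        fromℕ (k ℕ.* (h ℕ.* (n ℕ.∸ h))) * B
          ≡⟨ cong (_* B) (trans (fromℕ-* k _) (cong (κ *_) (fromℕ-* h (n ℕ.∸ h)))) ⟩
        (κ * (fromℕ h * fromℕ (n ℕ.∸ h))) * B
          ≡⟨ solve 4 (λ t u v w → (t :* (u :* v)) :* w := t :* (u :* (v :* w))) refl κ _ _ B ⟩
        κ * (fromℕ h * (fromℕ (n ℕ.∸ h) * B))
          -- First `b` goes to one of `h` early positions; by `late`, each such choice leaves
          -- `n - h` good positions for `m`.
          ≤⟨ *-monoʳ-≤ (fromℕ-nonneg k) (sumInsertions-early h b p
               (subst (λ k → h ℕ.≤ suc k) (sym (↭-length p↭r)) h≤)
               (λ q → sum-nonneg (All.universal 0≤f (insertions m q)))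
               (late p p↭r)) ⟩
        κ * sumInsertions (sumInsertions f m) b p
          ∎
        where open Solver using (solve; _:*_; _:=_)

-- Finitely supported distributions and their expectations.

module Distributions {c ℓ} (𝔽 : OrderedField c ℓ) where

  open OrderedField 𝔽
  open PenTesting 𝔽
  open OrderedFieldProperties 𝔽
  open Sums 𝔽

  weightedSum : ∀ {a} {A : Set a} → List (Carrier × A) → (A → Carrier) → Carrier
  weightedSum ps f = sum (map (λ (w , x) → w * f x) ps)

  -- The randomness of a `Player` as a value of its own, so that it can be composed before
  -- strategies are attached to it.
  record Distribution (A : Set) : Set (c ⊔ ℓ) where
    field
      support : List (Carrier × A)
      nonneg  : All (λ p → 0# ≤ proj₁ p) support
      sum≡1   : sum (map proj₁ support) ≡ 1#

  𝔼 : ∀ {A : Set} → Distribution A → (A → Carrier) → Carrier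
  𝔼 d = weightedSum (Distribution.support d)

  module _ {A : Set} (d : Distribution A) where

    open Distribution d

    𝔼-cong : ∀ {f g} → (∀ x → f x ≡ g x) → 𝔼 d f ≡ 𝔼 d g
    𝔼-cong f≗g = sum-cong support (λ (w , x) → cong (w *_) (f≗g x))

    𝔼-mono : ∀ {f g} → (∀ x → f x ≤ g x) → 𝔼 d f ≤ 𝔼 d g
    𝔼-mono f≤g = sum-mono (All.map (λ {p} 0≤w → *-monoʳ-≤ 0≤w (f≤g (proj₂ p))) nonneg)

    𝔼-const : ∀ z → 𝔼 d (λ _ → z) ≡ z
    𝔼-const z = trans (sum-*ʳ z proj₁ support) (trans (cong (_* z) sum≡1) (*-identityˡ z))

    𝔼-nonneg : ∀ {f} → (∀ x → 0# ≤ f x) → 0# ≤ 𝔼 d f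
    𝔼-nonneg 0≤f = subst (_≤ 𝔼 d _) (𝔼-const 0#) (𝔼-mono 0≤f)

  return : ∀ {A : Set} → A → Distribution A
  return x = record
    { support = (1# , x) ∷ []
    ; nonneg  = 0≤1 ∷ []
    ; sum≡1   = +-identityʳ 1#
    }

  𝔼-return : ∀ {A : Set} (x : A) f → 𝔼 (return x) f ≡ f x
  𝔼-return x f = trans (+-identityʳ _) (*-identityˡ (f x))

  module _ {A B : Set} (d : Distribution A) (k : A → Distribution B) where

    open Distribution

    private
      scale : Carrier × A → List (Carrier × B)
      scale (w , x) = map (λ (v , y) → w * v , y) (support (k x))

      weightedSum-bind : ∀ f → weightedSum (concatMap scale (support d)) f ≡ 𝔼 d (λ x → 𝔼 (k x) f)
      weightedSum-bind f = trans
        (sum-concatMap _ scale (support d))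
        (sum-cong (support d) λ (w , x) → trans
          (cong sum (sym (map-∘ (support (k x)))))
          (trans (sum-cong (support (k x)) (λ (v , y) → *-assoc w v (f y)))
                   (sum-*ˡ w _ (support (k x)))))

    bind : Distribution B
    bind .support = concatMap scale (support d)
    bind .nonneg  = All.concat⁺ (All.map⁺ (All.map
      (λ {p} 0≤w → All.map⁺ (All.map (*-nonneg 0≤w) (nonneg (k (proj₂ p))))) (nonneg d)))
    bind .sum≡1   = begin
      -- The total weight is the expectation of the constant 1, which `weightedSum-bind` evaluates.
      sum (map proj₁ (support bind))        ≡⟨ sum-cong (support bind) (λ p → sym (*-identityʳ (proj₁ p))) ⟩
      weightedSum (support bind) (λ _ → 1#) ≡⟨ weightedSum-bind _ ⟩
      𝔼 d (λ x → 𝔼 (k x) (λ _ → 1#))        ≡⟨ 𝔼-cong d (λ x → 𝔼-const (k x) 1#) ⟩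
      𝔼 d (λ _ → 1#)                        ≡⟨ 𝔼-const d 1# ⟩
      1#                                    ∎
      where open ≡-Reasoning

    𝔼-bind : ∀ f → 𝔼 bind f ≡ 𝔼 d (λ x → 𝔼 (k x) f)
    𝔼-bind = weightedSum-bind

  module _ {A : Set} where

    _◂_ : A → (ℕ → A) → ℕ → A
    (x ◂ xs) zero    = x
    (x ◂ xs) (suc i) = xs i

    -- Infinite sequences keep the length out of the seed type: the given number of initial entries
    -- are independent draws, and all later entries equal the filler.
    iid : Distribution A → A → ℕ → Distribution (ℕ → A)
    prepend : Distribution A → A → ℕ → A → Distribution (ℕ → A)

    iid d z zero    = return (λ _ → z)
    iid d z (suc n) = bind d (prepend d z n)

    prepend d z n x = bind (iid d z n) (λ xs → return (x ◂ xs))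

    𝔼-iid-suc : ∀ d z n f → 𝔼 (iid d z (suc n)) f ≡ 𝔼 d (λ x → 𝔼 (iid d z n) (λ xs → f (x ◂ xs)))
    𝔼-iid-suc d z n f = trans (𝔼-bind d (prepend d z n) f) (𝔼-cong d λ x →
      trans (𝔼-bind (iid d z n) (λ xs → return (x ◂ xs)) f)
              (𝔼-cong (iid d z n) (λ xs → 𝔼-return (x ◂ xs) f)))

-- Accepting the first pass, and geometrically weighted threshold levels.

module Thresholds {c ℓ} (𝔽 : OrderedField c ℓ) where

  open OrderedField 𝔽
  open PenTesting 𝔽
  open OrderedFieldProperties 𝔽
  open Sums 𝔽
  open Distributions 𝔽
  open BinaryMax totalOrder using (x≤x⊔y; x≤y⊔x; x≤y⇒x⊔y≈y)

  isPassed : Outcome → Bool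
  isPassed passed     = true
  isPassed (failed _) = false

  -- One round of a player that accepts the first pass. The last argument is the value of continuing
  -- after a failure, so that games can be evaluated from their end.
  payoff : Threshold → Carrier → Carrier → Carrier
  payoff θ x v = if isPassed (test x θ) then remaining x θ else v

  play : (ℕ → Threshold) → List Carrier → Carrier
  play θs []       = 0#
  play θs (x ∷ xs) = payoff (θs 0) x (play (θs ∘ suc) xs)

  module _ {x θ : Carrier} (0≤θ : 0# ≤ θ) where

    payoff-fail : ∀ {v} → x ≤ θ → payoff (finite θ 0≤θ) x v ≡ v
    payoff-fail x≤θ rewrite dec-true (x ≤? θ) x≤θ = refl

    remaining-fail : x ≤ θ → remaining x (finite θ 0≤θ) ≡ 0#
    remaining-fail x≤θ = x≤y⇒x⊔y≈y
      (subst (_ ≤_) (-‿inverseʳ θ) (+-monoˡ-≤ (- θ) x≤θ))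

    x≤θ+remaining : x ≤ θ + remaining x (finite θ 0≤θ)
    x≤θ+remaining = ≤-trans (≤-reflexive (trans (sym (x-y+y≡x x θ)) (+-comm (x - θ) θ)))
                            (+-monoʳ-≤ θ (x≤x⊔y (x - θ) 0#))

  remaining-nonneg : ∀ x θ → 0# ≤ remaining x θ
  remaining-nonneg x (finite θ _) = x≤y⊔x (x - θ) 0#
  remaining-nonneg x ∞            = ≤-refl

  payoff-mono : ∀ θ x {u v} → u ≤ v → payoff θ x u ≤ payoff θ x v
  payoff-mono θ x u≤v with isPassed (test x θ)
  ... | true  = ≤-refl
  ... | false = u≤v

  payoff-nonneg : ∀ θ x {v} → 0# ≤ v → 0# ≤ payoff θ x v
  payoff-nonneg θ x 0≤v with isPassed (test x θ)
  ... | true  = remaining-nonneg x θ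
  ... | false = 0≤v

  remaining≤payoff : ∀ θ x {v} → 0# ≤ v → remaining x θ ≤ payoff θ x v
  remaining≤payoff ∞ x 0≤v = 0≤v
  remaining≤payoff (finite θ 0≤θ) x 0≤v with x ≤? θ in eq
  ... | no _    = ≤-refl
  ... | yes x≤θ = subst (_≤ _) (sym (remaining-fail 0≤θ x≤θ)) 0≤v

  play-nonneg : ∀ θs xs → 0# ≤ play θs xs
  play-nonneg θs []       = ≤-refl
  play-nonneg θs (x ∷ xs) = payoff-nonneg (θs 0) x (play-nonneg (θs ∘ suc) xs)

  -- As a function of the continuation value, a round is either constant or the identity, so the
  -- average over later randomness moves inside.
  𝔼-payoff : ∀ {A : Set} (d : Distribution A) θ x f →
             𝔼 d (λ a → payoff θ x (f a)) ≡ payoff θ x (𝔼 d f)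
  𝔼-payoff d θ x f with isPassed (test x θ)
  ... | true  = 𝔼-const d (remaining x θ)
  ... | false = refl

  -- Repeated addition instead of powers: each level being twice as likely as the one below it then
  -- holds by definition.
  doubling : Carrier → ℕ → Carrier
  doubling w zero    = w
  doubling w (suc j) = doubling w j + doubling w j

  doubling≡2^* : ∀ w j → doubling w j ≡ fromℕ (2 ℕ.^ j) * w
  doubling≡2^* w zero    = sym (trans (cong (_* w) (+-identityʳ 1#)) (*-identityˡ w))
  doubling≡2^* w (suc j) = begin
    doubling w j + doubling w j                        ≡⟨ cong₂ _+_ (doubling≡2^* w j) (doubling≡2^* w j) ⟩
    fromℕ (2 ℕ.^ j) * w + fromℕ (2 ℕ.^ j) * w          ≡⟨ distribʳ w _ _ ⟨
    (fromℕ (2 ℕ.^ j) + fromℕ (2 ℕ.^ j)) * w            ≡⟨ cong (_* w) (fromℕ-+ (2 ℕ.^ j) (2 ℕ.^ j)) ⟨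
    fromℕ (2 ℕ.^ j ℕ.+ 2 ℕ.^ j) * w                    ≡⟨ cong (λ k → fromℕ (2 ℕ.^ j ℕ.+ k) * w) (ℕ.+-identityʳ (2 ℕ.^ j)) ⟨
    fromℕ (2 ℕ.^ suc j) * w                            ∎
    where open ≡-Reasoning

  doubling-nonneg : ∀ {w} → 0# ≤ w → ∀ j → 0# ≤ doubling w j
  doubling-nonneg 0≤w zero    = 0≤w
  doubling-nonneg 0≤w (suc j) = +-nonneg (doubling-nonneg 0≤w j) (doubling-nonneg 0≤w j)

  -- Level `j` has weight 2^j `w`, and the total is not normalised. The value `nothing` is kept for
  -- the threshold `∞`, which later receives the missing mass.
  geometric : Carrier → ℕ → List (Carrier × Maybe ℕ)
  geometric w zero    = (w , just 0) ∷ []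
  geometric w (suc k) = (doubling w (suc k) , just (suc k)) ∷ geometric w k

  -- The geometric series 1 + 2 + ... + 2^k = 2^(k+1) - 1, written without subtraction.
  geometric-total : ∀ w k → sum (map proj₁ (geometric w k)) + w ≡ doubling w (suc k)
  geometric-total w zero    = cong (_+ w) (+-identityʳ w)
  geometric-total w (suc k) =
    trans (+-assoc _ _ w) (cong (doubling w (suc k) +_) (geometric-total w k))

  geometric-nonneg : ∀ {w} → 0# ≤ w → ∀ k → All (λ p → 0# ≤ proj₁ p) (geometric w k)
  geometric-nonneg 0≤w zero    = 0≤w ∷ []
  geometric-nonneg 0≤w (suc k) = doubling-nonneg 0≤w (suc k) ∷ geometric-nonneg 0≤w k

  top-term : ∀ {w} → 0# ≤ w → ∀ {f} → (∀ j → 0# ≤ f j) → ∀ k →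
             doubling w k * f (just k) ≤ weightedSum (geometric w k) f
  top-term 0≤w 0≤f zero    = x≤x+y ≤-refl
  top-term 0≤w 0≤f (suc k) = x≤x+y (sum-nonneg
    (All.map (λ {p} 0≤v → *-nonneg 0≤v (0≤f (proj₂ p))) (geometric-nonneg 0≤w k)))

  module Levels {τ : Carrier} (0≤τ : 0# ≤ τ) where

    gridPoint : ℕ → Carrier
    gridPoint j = fromℕ j * (τ + τ)

    gridPoint-suc : ∀ j → gridPoint (suc j) ≡ gridPoint j + (τ + τ)
    gridPoint-suc j = trans (distribʳ (τ + τ) 1# (fromℕ j))
      (trans (+-comm _ _) (cong (gridPoint j +_) (*-identityˡ (τ + τ))))

    gridPoint-nonneg : ∀ j → 0# ≤ gridPoint j
    gridPoint-nonneg j = *-nonneg (fromℕ-nonneg j) (+-nonneg 0≤τ 0≤τ)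

    threshold : Maybe ℕ → Threshold
    threshold nothing  = ∞
    threshold (just j) = finite (gridPoint j) (gridPoint-nonneg j)

    -- If level k + 1 is passed then level k leaves at least 2 τ, and level
    -- k + 1 is only twice as likely: the mass lost at level k + 1 is charged to
    -- the gain at level k, and only the mass w of level 0 is left unpaid.
    geometric-drain : ∀ {w} → 0# ≤ w → ∀ x {v} → v ≤ τ → ∀ k →
      sum (map proj₁ (geometric w k)) * v + doubling w k * remaining x (threshold (just k))
        ≤ weightedSum (geometric w k) (λ j → payoff (threshold j) x v) + w * τ
    geometric-drain {w} 0≤w x {v} v≤τ zero with x ≤? gridPoint 0
    ... | yes x≤θ = begin
      (w + 0#) * v + w * remaining x (threshold (just 0))  ≡⟨ cong (λ t → (w + 0#) * v + w * t) (remaining-fail (gridPoint-nonneg 0) x≤θ) ⟩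
      (w + 0#) * v + w * 0#   ≡⟨ solve 2 (λ w v → (w :+ con 0) :* v :+ w :* con 0 := w :* v :+ con 0) refl w v ⟩
      w * v + 0#              ≤⟨ x≤x+y (*-nonneg 0≤w 0≤τ) ⟩
      (w * v + 0#) + w * τ    ∎
      where
      open ≤-Reasoning
      open Solver
    ... | no x≰θ = begin
      (w + 0#) * v + w * r     ≡⟨ solve 3 (λ w v r → (w :+ con 0) :* v :+ w :* r := (w :* r :+ con 0) :+ w :* v) refl w v r ⟩
      (w * r + 0#) + w * v     ≤⟨ +-monoʳ-≤ _ (*-monoʳ-≤ 0≤w v≤τ) ⟩
      (w * r + 0#) + w * τ     ∎
      where
      open ≤-Reasoning
      open Solver
      r = remaining x (threshold (just 0))
    geometric-drain {w} 0≤w x {v} v≤τ (suc k) with geometric-drain 0≤w x v≤τ k | x ≤? gridPoint (suc k)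
    ... | ih | yes x≤θ = begin
      (u + t) * v + u * remaining x (threshold (just (suc k)))  ≡⟨ cong (λ s → (u + t) * v + u * s) (remaining-fail (gridPoint-nonneg (suc k)) x≤θ) ⟩
      (u + t) * v + u * 0#  ≡⟨ solve 3 (λ u t v → (u :+ t) :* v :+ u :* con 0 := u :* v :+ t :* v) refl u t v ⟩
      -- Level `k + 1` fails, so its share of `v` survives; the surplus that the induction
      -- hypothesis holds at level `k` is given away.
      u * v + t * v         ≤⟨ +-monoʳ-≤ (u * v) (≤-trans (x≤x+y (*-nonneg (doubling-nonneg 0≤w k) (remaining-nonneg x (threshold (just k))))) ih) ⟩
      u * v + (p + w * τ)   ≡⟨ +-assoc (u * v) p (w * τ) ⟨
      (u * v + p) + w * τ   ∎
      where
      open ≤-Reasoning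
      open Solver
      u = doubling w (suc k)
      t = sum (map proj₁ (geometric w k))
      p = weightedSum (geometric w k) (λ j → payoff (threshold j) x v)
    ... | ih | no x≰θ = begin
      ((d + d) + t) * v + (d + d) * r′
        ≡⟨ solve 4 (λ d t v r → ((d :+ d) :+ t) :* v :+ (d :+ d) :* r := (d :+ d) :* r :+ (t :* v :+ d :* (v :+ v))) refl d t v r′ ⟩
      (d + d) * r′ + (t * v + d * (v + v))
        ≤⟨ +-monoʳ-≤ _ (+-monoʳ-≤ _ (*-monoʳ-≤ (doubling-nonneg 0≤w k) (≤-trans (+-mono-≤ v≤τ v≤τ) 2τ≤r))) ⟩
      (d + d) * r′ + (t * v + d * r)     ≤⟨ +-monoʳ-≤ _ ih ⟩
      (d + d) * r′ + (p + w * τ)         ≡⟨ +-assoc _ p (w * τ) ⟨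
      ((d + d) * r′ + p) + w * τ         ∎
      where
      open ≤-Reasoning
      open Solver
      d  = doubling w k
      t  = sum (map proj₁ (geometric w k))
      p  = weightedSum (geometric w k) (λ j → payoff (threshold j) x v)
      r  = remaining x (threshold (just k))
      r′ = remaining x (threshold (just (suc k)))
      θ≤x : gridPoint (suc k) ≤ x
      θ≤x with total (gridPoint (suc k)) x
      ... | inj₁ θ≤x = θ≤x
      ... | inj₂ x≤θ = contradiction x≤θ x≰θ
      2τ≤r : τ + τ ≤ r
      2τ≤r = +-cancelˡ-≤ (gridPoint k)
        (≤-trans (subst (_≤ x) (gridPoint-suc k) θ≤x) (x≤θ+remaining (gridPoint-nonneg k)))

-- Expected score of the strategy with independent random levels.

module Guarantee {c ℓ} (𝔽 : OrderedField c ℓ) (L : ℕ) where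

  open OrderedField 𝔽
  open PenTesting 𝔽
  open OrderedFieldProperties 𝔽
  open Sums 𝔽
  open Distributions 𝔽
  open Thresholds 𝔽
  open BinaryMax totalOrder using (x≤y⊔x; x≤y⇒y⊔x≈y) renaming (_⊔_ to _max_)

  private
    2^[2+L]≢0 : fromℕ (2 ℕ.^ (2 ℕ.+ L)) ≢ 0#
    2^[2+L]≢0 = fromℕ≢0 (ℕ.m^n>0 2 (2 ℕ.+ L))

    -- With this unit the levels 0 to `L` have total mass 1/2 - `w`, the top level has mass 1/4, and
    -- 2^(1 + L) rounds cost at most 1/2 in units of τ.
    w : Carrier
    w = fromℕ (2 ℕ.^ (2 ℕ.+ L)) ⁻¹

    w-nonneg : 0# ≤ w
    w-nonneg = ⁻¹-nonneg (fromℕ-nonneg (2 ℕ.^ (2 ℕ.+ L))) 2^[2+L]≢0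

    doubling≡1 : doubling w (2 ℕ.+ L) ≡ 1#
    doubling≡1 = trans (doubling≡2^* w (2 ℕ.+ L)) (⁻¹-inverseʳ 2^[2+L]≢0)

    mass : Carrier
    mass = sum (map proj₁ (geometric w L))

    mass≤1 : mass ≤ 1#
    mass≤1 = begin
      mass                                      ≤⟨ x≤x+y w-nonneg ⟩
      mass + w                                  ≡⟨ geometric-total w L ⟩
      doubling w (suc L)                        ≤⟨ x≤x+y (doubling-nonneg w-nonneg (suc L)) ⟩
      doubling w (suc L) + doubling w (suc L)   ≡⟨ doubling≡1 ⟩
      1#                                        ∎
      where open ≤-Reasoning

  levels : Distribution (Maybe ℕ)
  levels = record
    { support = (1# - mass , nothing) ∷ geometric w L
    ; nonneg  = x≤y⇒0≤y-x mass≤1 ∷ geometric-nonneg w-nonneg L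
    ; sum≡1   = x-y+y≡x 1# mass
    }

  module _ {τ : Carrier} (0≤τ : 0# ≤ τ) where

    open Levels 0≤τ

    round : Carrier → Carrier → Carrier
    round x v = 𝔼 levels (λ j → payoff (threshold j) x v)

    -- Adds to `geometric-drain` the mass on `∞`, where the test always fails and `v` is kept in
    -- full.
    round-drain : ∀ x {v} → v ≤ τ → v ≤ round x v + w * τ
    round-drain x {v} v≤τ = begin
      v                                ≡⟨ *-identityˡ v ⟨
      1# * v                           ≡⟨ cong (_* v) (x-y+y≡x 1# mass) ⟨
      ((1# - mass) + mass) * v         ≡⟨ distribʳ v (1# - mass) mass ⟩
      (1# - mass) * v + mass * v
        ≤⟨ +-monoʳ-≤ _ (≤-trans (x≤x+y (*-nonneg (doubling-nonneg w-nonneg L) (remaining-nonneg x (threshold (just L)))))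
                                (geometric-drain w-nonneg x v≤τ L)) ⟩
      (1# - mass) * v + (weightedSum (geometric w L) (λ j → payoff (threshold j) x v) + w * τ)
                                       ≡⟨ +-assoc _ _ (w * τ) ⟨
      round x v + w * τ                ∎
      where open ≤-Reasoning

    -- The top level `L` suffices: it is drawn with probability 1/4 and lies two grid steps, that is
    -- 4 τ, below the end of the grid.
    round-gain : ∀ x {v} → 0# ≤ v → gridPoint (2 ℕ.+ L) ≤ x → τ ≤ round x v
    round-gain x {v} 0≤v M≤x = begin
      τ                                 ≡⟨ *-identityˡ τ ⟨
      1# * τ                            ≡⟨ cong (_* τ) doubling≡1 ⟨
      doubling w (2 ℕ.+ L) * τ
        ≡⟨ solve 2 (λ d τ → ((d :+ d) :+ (d :+ d)) :* τ := d :* ((τ :+ τ) :+ (τ :+ τ))) refl u τ ⟩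
      u * ((τ + τ) + (τ + τ))           ≤⟨ *-monoʳ-≤ 0≤u 4τ≤r ⟩
      u * remaining x (threshold (just L))
        ≤⟨ *-monoʳ-≤ 0≤u (remaining≤payoff (threshold (just L)) x 0≤v) ⟩
      u * payoff (threshold (just L)) x v
        ≤⟨ top-term w-nonneg (λ j → payoff-nonneg (threshold j) x 0≤v) L ⟩
      weightedSum (geometric w L) (λ j → payoff (threshold j) x v)
        ≤⟨ x≤y+x (*-nonneg (x≤y⇒0≤y-x mass≤1) 0≤v) ⟩
      round x v                         ∎
      where
      open ≤-Reasoning
      open Solver
      u = doubling w L
      0≤u = doubling-nonneg w-nonneg L
      4τ≤r : (τ + τ) + (τ + τ) ≤ remaining x (threshold (just L))
      4τ≤r = +-cancelˡ-≤ (gridPoint L) (begin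
        gridPoint L + ((τ + τ) + (τ + τ))   ≡⟨ +-assoc (gridPoint L) (τ + τ) (τ + τ) ⟨
        (gridPoint L + (τ + τ)) + (τ + τ)   ≡⟨ cong (_+ (τ + τ)) (gridPoint-suc L) ⟨
        gridPoint (suc L) + (τ + τ)         ≡⟨ gridPoint-suc (suc L) ⟨
        gridPoint (2 ℕ.+ L)                 ≤⟨ M≤x ⟩
        x                                   ≤⟨ x≤θ+remaining (gridPoint-nonneg L) ⟩
        gridPoint L + remaining x (threshold (just L)) ∎)

    expectedPlay : List Carrier → Carrier
    expectedPlay xs = 𝔼 (iid levels nothing (length xs)) (λ ℓs → play (threshold ∘ ℓs) xs)

    expectedPlay-nonneg : ∀ xs → 0# ≤ expectedPlay xs
    expectedPlay-nonneg xs = 𝔼-nonneg (iid levels nothing (length xs)) (λ ℓs → play-nonneg (threshold ∘ ℓs) xs)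

    -- Independence of the levels turns the expected score into a backward recursion.
    expectedPlay-∷ : ∀ x xs → expectedPlay (x ∷ xs) ≡ round x (expectedPlay xs)
    expectedPlay-∷ x xs = trans
      (𝔼-iid-suc levels nothing (length xs) (λ ℓs → play (threshold ∘ ℓs) (x ∷ xs)))
      (𝔼-cong levels (λ j → 𝔼-payoff (iid levels nothing (length xs)) (threshold j) x (λ ℓs → play (threshold ∘ ℓs) xs)))

    -- Induction from the large option towards the front: its own round is worth τ, and each earlier
    -- round loses at most `w * τ` of that value.
    expectedPlay-drain : ∀ {xs} → Any (gridPoint (2 ℕ.+ L) ≤_) xs →
                         τ ≤ expectedPlay xs + fromℕ (length xs) * (w * τ)
    expectedPlay-drain {x ∷ xs} (here M≤x) = begin
      τ                           ≤⟨ round-gain x (expectedPlay-nonneg xs) M≤x ⟩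
      round x (expectedPlay xs)   ≡⟨ expectedPlay-∷ x xs ⟨
      expectedPlay (x ∷ xs)       ≤⟨ x≤x+y (*-nonneg (fromℕ-nonneg (suc (length xs))) (*-nonneg w-nonneg 0≤τ)) ⟩
      expectedPlay (x ∷ xs) + fromℕ (suc (length xs)) * (w * τ) ∎
      where open ≤-Reasoning
    expectedPlay-drain {x ∷ xs} (there any) with total (expectedPlay xs) τ
    ... | inj₁ v≤τ = begin
      τ                                    ≤⟨ expectedPlay-drain any ⟩
      v + fromℕ (length xs) * (w * τ)      ≤⟨ +-monoˡ-≤ _ (round-drain x v≤τ) ⟩
      (round x v + w * τ) + fromℕ (length xs) * (w * τ)  ≡⟨ +-assoc (round x v) (w * τ) _ ⟩
      round x v + (w * τ + fromℕ (length xs) * (w * τ))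
        ≡⟨ cong₂ _+_ (expectedPlay-∷ x xs) (fromℕ-suc-* (length xs) (w * τ)) ⟨
      expectedPlay (x ∷ xs) + fromℕ (suc (length xs)) * (w * τ) ∎
      where
      open ≤-Reasoning
      v = expectedPlay xs
    -- `round-drain` applies to continuations of value at most τ, so a larger one is lowered to τ by
    -- monotonicity.
    ... | inj₂ τ≤v = begin
      τ                                    ≤⟨ round-drain x {τ} ≤-refl ⟩
      round x τ + w * τ                    ≤⟨ +-monoˡ-≤ (w * τ) (𝔼-mono levels (λ j → payoff-mono (threshold j) x τ≤v)) ⟩
      round x v + w * τ
        ≤⟨ +-monoʳ-≤ (round x v) (x≤x+y (*-nonneg (fromℕ-nonneg (length xs)) (*-nonneg w-nonneg 0≤τ))) ⟩
      round x v + (w * τ + fromℕ (length xs) * (w * τ))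
        ≡⟨ cong₂ _+_ (expectedPlay-∷ x xs) (fromℕ-suc-* (length xs) (w * τ)) ⟨
      expectedPlay (x ∷ xs) + fromℕ (suc (length xs)) * (w * τ) ∎
      where
      open ≤-Reasoning
      v = expectedPlay xs

    -- The rounds together lose at most τ / 2; doubling the drain inequality and cancelling τ avoids
    -- the fraction.
    expectedPlay-bound : ∀ {xs} → length xs ℕ.≤ 2 ℕ.^ (1 ℕ.+ L) → Any (gridPoint (2 ℕ.+ L) ≤_) xs →
                         τ ≤ expectedPlay xs + expectedPlay xs
    expectedPlay-bound {xs} n≤ any = +-cancelʳ-≤ τ (begin
      τ + τ                             ≤⟨ +-mono-≤ (expectedPlay-drain any) (expectedPlay-drain any) ⟩
      (v + k * (w * τ)) + (v + k * (w * τ))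
        ≡⟨ solve 4 (λ v k w t → (v :+ k :* (w :* t)) :+ (v :+ k :* (w :* t)) := (v :+ v) :+ ((k :+ k) :* w) :* t) refl v k w τ ⟩
      (v + v) + ((k + k) * w) * τ
        ≤⟨ +-monoʳ-≤ (v + v) (*-monoˡ-≤ 0≤τ 2kw≤1) ⟩
      (v + v) + 1# * τ                  ≡⟨ cong (v + v +_) (*-identityˡ τ) ⟩
      (v + v) + τ                       ∎)
      where
      open ≤-Reasoning
      open Solver
      v = expectedPlay xs
      k = fromℕ (length xs)
      2k≤ : k + k ≤ fromℕ (2 ℕ.^ (2 ℕ.+ L))
      2k≤ = begin
        k + k                                    ≡⟨ fromℕ-+ (length xs) (length xs) ⟨
        fromℕ (length xs ℕ.+ length xs)
          ≤⟨ fromℕ-mono-≤ (ℕ.+-mono-≤ n≤ (ℕ.≤-trans n≤ (ℕ.≤-reflexive (sym (ℕ.+-identityʳ _))))) ⟩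
        fromℕ (2 ℕ.^ (2 ℕ.+ L))                  ∎
      2kw≤1 : (k + k) * w ≤ 1#
      2kw≤1 = ≤-trans (*-monoˡ-≤ w-nonneg 2k≤) (≤-reflexive (⁻¹-inverseʳ 2^[2+L]≢0))

  -- Half a grid step τ, such that `2 + L` steps of length 2 τ reach from 0 to `M`. Thresholds must
  -- be legal for every scalar `M`, hence the truncation at 0.
  spacing : Carrier → Carrier
  spacing M = fromℕ (2 ℕ.* (2 ℕ.+ L)) ⁻¹ * (M max 0#)

  spacing-nonneg : ∀ M → 0# ≤ spacing M
  spacing-nonneg M = *-nonneg
    (⁻¹-nonneg (fromℕ-nonneg (2 ℕ.* (2 ℕ.+ L))) (fromℕ≢0 {2 ℕ.* (2 ℕ.+ L)} (s≤s z≤n))) (x≤y⊔x M 0#)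

  thresholdFor : Carrier → Maybe ℕ → Threshold
  thresholdFor M = Levels.threshold (spacing-nonneg M)

  2[2+L]*spacing≡M : ∀ {M} → 0# ≤ M → fromℕ (2 ℕ.* (2 ℕ.+ L)) * spacing M ≡ M
  2[2+L]*spacing≡M {M} 0≤M = begin
    d * (d ⁻¹ * (M max 0#))   ≡⟨ *-assoc d (d ⁻¹) (M max 0#) ⟨
    (d * d ⁻¹) * (M max 0#)   ≡⟨ cong₂ _*_ (⁻¹-inverseʳ (fromℕ≢0 {2 ℕ.* (2 ℕ.+ L)} (s≤s z≤n))) (x≤y⇒y⊔x≈y 0≤M) ⟩
    1# * M                    ≡⟨ *-identityˡ M ⟩
    M                         ∎
    where
    open ≡-Reasoning
    d = fromℕ (2 ℕ.* (2 ℕ.+ L))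

  gridPoint-top : ∀ {M} → 0# ≤ M → Levels.gridPoint (spacing-nonneg M) (2 ℕ.+ L) ≡ M
  gridPoint-top {M} 0≤M = begin
    fromℕ (2 ℕ.+ L) * (τ + τ)              ≡⟨ solve 2 (λ k t → k :* (t :+ t) := (con 2 :* k) :* t) refl (fromℕ (2 ℕ.+ L)) τ ⟩
    ((1# + 1#) * fromℕ (2 ℕ.+ L)) * τ      ≡⟨ cong (λ t → (1# + t) * fromℕ (2 ℕ.+ L) * τ) (+-identityʳ 1#) ⟨
    (fromℕ 2 * fromℕ (2 ℕ.+ L)) * τ        ≡⟨ cong (_* τ) (fromℕ-* 2 (2 ℕ.+ L)) ⟨
    fromℕ (2 ℕ.* (2 ℕ.+ L)) * τ            ≡⟨ 2[2+L]*spacing≡M 0≤M ⟩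
    M                                      ∎
    where
    open ≡-Reasoning
    open Solver
    τ = spacing M

  -- A score of τ / 2 with τ = M / (2 (2 + L)) gives the factor 4 (2 + L) = 8 + 4 L, at most 12 L
  -- because `L` is at least 1. The number `k` of drawn levels is separate from the list since the
  -- players fix it in terms of `n`.
  iid-guarantee : ∀ {M} k xs → 1 ℕ.≤ L → k ≡ length xs → length xs ℕ.≤ 2 ℕ.^ (1 ℕ.+ L) →
    0# ≤ M → Any (M ≤_) xs →
    M ≤ fromℕ (12 ℕ.* L) * 𝔼 (iid levels nothing k) (λ ℓs → play (thresholdFor M ∘ ℓs) xs)
  iid-guarantee {M} k xs 1≤L refl n≤ 0≤M any = begin
    M                                               ≡⟨ 2[2+L]*spacing≡M 0≤M ⟨
    fromℕ (2 ℕ.* (2 ℕ.+ L)) * spacing M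
      ≤⟨ *-monoʳ-≤ (fromℕ-nonneg (2 ℕ.* (2 ℕ.+ L))) (expectedPlay-bound (spacing-nonneg M) n≤
           (subst (λ m → Any (m ≤_) xs) (sym (gridPoint-top 0≤M)) any)) ⟩
    fromℕ (2 ℕ.* (2 ℕ.+ L)) * (v + v)               ≡⟨ solve 2 (λ k v → k :* (v :+ v) := (k :+ k) :* v) refl _ v ⟩
    (fromℕ (2 ℕ.* (2 ℕ.+ L)) + fromℕ (2 ℕ.* (2 ℕ.+ L))) * v  ≡⟨ cong (_* v) (fromℕ-+ (2 ℕ.* (2 ℕ.+ L)) _) ⟨
    fromℕ (2 ℕ.* (2 ℕ.+ L) ℕ.+ 2 ℕ.* (2 ℕ.+ L)) * v
      ≤⟨ *-monoˡ-≤ (expectedPlay-nonneg (spacing-nonneg M) xs) (fromℕ-mono-≤ 4[2+L]≤12L) ⟩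
    fromℕ (12 ℕ.* L) * v                            ∎
    where
    open ≤-Reasoning
    open Solver
    v = expectedPlay (spacing-nonneg M) xs
    4[2+L]≤12L : 2 ℕ.* (2 ℕ.+ L) ℕ.+ 2 ℕ.* (2 ℕ.+ L) ℕ.≤ 12 ℕ.* L
    4[2+L]≤12L = ℕ.≤-trans (ℕ.≤-reflexive (ℕ-solve 1 (λ l → con′ 2 ℕ:* (con′ 2 ℕ:+ l) ℕ:+ con′ 2 ℕ:* (con′ 2 ℕ:+ l) ℕ:= con′ 8 ℕ:+ con′ 4 ℕ:* l) refl L))
      (ℕ.≤-trans (ℕ.+-monoˡ-≤ (4 ℕ.* L) (ℕ.*-monoʳ-≤ 8 1≤L))
                 (ℕ.≤-reflexive (sym (ℕ.*-distribʳ-+ L 8 4))))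
      where open +-*-Solver using () renaming (solve to ℕ-solve; con to con′; _:+_ to _ℕ:+_; _:*_ to _ℕ:*_; _:=_ to _ℕ:=_)

-- Estimates for rounded logarithms and halves.

n≤2^[1+⌊log₂n⌋] : ∀ n → n ℕ.≤ 2 ℕ.^ (1 ℕ.+ ⌊log₂ n ⌋)
n≤2^[1+⌊log₂n⌋] n with ℕ.≤-total n (2 ℕ.^ (1 ℕ.+ ⌊log₂ n ⌋))
... | inj₁ n≤2^ = n≤2^
-- Taking logarithms here would give 1 + ⌊log₂ n⌋ ≤ ⌊log₂ n⌋.
... | inj₂ 2^≤n = contradiction
  (subst (ℕ._≤ ⌊log₂ n ⌋) (⌊log₂[2^n]⌋≡n (1 ℕ.+ ⌊log₂ n ⌋)) (⌊log₂⌋-mono-≤ 2^≤n))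
  (ℕ.<⇒≱ ℕ.≤-refl)

⌈n/2⌉≡⌊n/2⌋⊎1+⌊n/2⌋ : ∀ n → ⌈ n /2⌉ ≡ ⌊ n /2⌋ ⊎ ⌈ n /2⌉ ≡ suc ⌊ n /2⌋
⌈n/2⌉≡⌊n/2⌋⊎1+⌊n/2⌋ zero          = inj₁ refl
⌈n/2⌉≡⌊n/2⌋⊎1+⌊n/2⌋ (suc zero)    = inj₂ refl
⌈n/2⌉≡⌊n/2⌋⊎1+⌊n/2⌋ (suc (suc n)) with ⌈n/2⌉≡⌊n/2⌋⊎1+⌊n/2⌋ n
... | inj₁ eq = inj₁ (cong suc eq)
... | inj₂ eq = inj₂ (cong suc eq)

-- At least a quarter of the ordered pairs of distinct positions have the first in the first half
-- and the second in the other half. By parity: 4 h^2 ≥ 2 h (2 h - 1), or 4 h (h + 1) ≥ (2 h + 1) 2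
-- h.
n[n-1]≤4⌊n/2⌋⌈n/2⌉ : ∀ m → let n = suc m in n ℕ.* m ℕ.≤ 4 ℕ.* (⌊ n /2⌋ ℕ.* (n ℕ.∸ ⌊ n /2⌋))
n[n-1]≤4⌊n/2⌋⌈n/2⌉ m = subst (λ k → n ℕ.* m ℕ.≤ 4 ℕ.* (h ℕ.* k)) (sym n∸h≡⌈n/2⌉) bound
  where
  open +-*-Solver
  n = suc m
  h = ⌊ n /2⌋
  n∸h≡⌈n/2⌉ : n ℕ.∸ h ≡ ⌈ n /2⌉
  n∸h≡⌈n/2⌉ = trans (cong (ℕ._∸ h) (sym (ℕ.⌊n/2⌋+⌈n/2⌉≡n n))) (ℕ.m+n∸m≡n h ⌈ n /2⌉)
  n≡h+ : ∀ {k} → ⌈ n /2⌉ ≡ k → n ≡ h ℕ.+ k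
  n≡h+ eq = trans (sym (ℕ.⌊n/2⌋+⌈n/2⌉≡n n)) (cong (h ℕ.+_) eq)
  bound : n ℕ.* m ℕ.≤ 4 ℕ.* (h ℕ.* ⌈ n /2⌉)
  bound with ⌈n/2⌉≡⌊n/2⌋⊎1+⌊n/2⌋ n
  ... | inj₁ eq = begin
    n ℕ.* m                      ≤⟨ ℕ.*-monoʳ-≤ n (ℕ.n≤1+n m) ⟩
    n ℕ.* n                      ≡⟨ cong₂ ℕ._*_ (n≡h+ eq) (n≡h+ eq) ⟩
    (h ℕ.+ h) ℕ.* (h ℕ.+ h)      ≡⟨ solve 1 (λ h → (h :+ h) :* (h :+ h) := con 4 :* (h :* h)) refl h ⟩
    4 ℕ.* (h ℕ.* h)              ≡⟨ cong (λ k → 4 ℕ.* (h ℕ.* k)) eq ⟨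
    4 ℕ.* (h ℕ.* ⌈ n /2⌉)        ∎
    where open ℕ.≤-Reasoning
  ... | inj₂ eq = begin
    n ℕ.* m                      ≡⟨ cong₂ ℕ._*_ (n≡h+ eq) (ℕ.suc-injective (trans (n≡h+ eq) (ℕ.+-suc h h))) ⟩
    (h ℕ.+ suc h) ℕ.* (h ℕ.+ h)  ≤⟨ ℕ.m≤m+n _ (2 ℕ.* h) ⟩
    (h ℕ.+ suc h) ℕ.* (h ℕ.+ h) ℕ.+ 2 ℕ.* h
      ≡⟨ solve 1 (λ h → (h :+ (con 1 :+ h)) :* (h :+ h) :+ con 2 :* h := con 4 :* (h :* (con 1 :+ h))) refl h ⟩
    4 ℕ.* (h ℕ.* suc h)          ≡⟨ cong (λ k → 4 ℕ.* (h ℕ.* k)) eq ⟨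
    4 ℕ.* (h ℕ.* ⌈ n /2⌉)        ∎
    where open ℕ.≤-Reasoning

-- From threshold sequences to strategies and players.

module Players {c ℓ} (𝔽 : OrderedField c ℓ) where

  open OrderedField 𝔽
  open PenTesting 𝔽
  open OrderedFieldProperties 𝔽
  open Sums 𝔽
  open Distributions 𝔽
  open Thresholds 𝔽
  open Extrema totalOrder using (max≈v⁺; max≤v⁺; ⊥≤max)

  acceptFirstPass : (List Outcome → Threshold) → Strategy
  acceptFirstPass ϑ = record { threshold = ϑ ; accept = λ _ → isPassed }

  scoreFrom-nonneg : ∀ s H xs → 0# ≤ scoreFrom s H xs
  scoreFrom-nonneg s H []       = ≤-refl
  scoreFrom-nonneg s H (x ∷ xs) with Strategy.accept s H (test x (Strategy.threshold s H))
  ... | true  = remaining-nonneg x (Strategy.threshold s H)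
  ... | false = scoreFrom-nonneg s _ xs

  -- From `H` on, only histories extending `H` occur, so thresholds need to be a function of time on
  -- those alone. This covers a strategy that has finished sampling.
  scoreFrom≡play : ∀ ϑ {θs} H xs → (∀ os → ϑ (os ++ H) ≡ θs (length os)) →
                   scoreFrom (acceptFirstPass ϑ) H xs ≡ play θs xs
  scoreFrom≡play ϑ H []       ϑ≗θs = refl
  scoreFrom≡play ϑ {θs} H (x ∷ xs) ϑ≗θs = cong₂ (λ θ v → payoff θ x v) (ϑ≗θs [])
    (scoreFrom≡play ϑ (o ∷ H) xs (λ os → begin
      ϑ (os ++ o ∷ H)          ≡⟨ cong ϑ (++-assoc os [ o ] H) ⟨
      ϑ ((os ++ [ o ]) ++ H)   ≡⟨ ϑ≗θs (os ++ [ o ]) ⟩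
      θs (length (os ++ [ o ]))  ≡⟨ cong θs (trans (length-++ os) (ℕ.+-comm (length os) 1)) ⟩
      θs (suc (length os))     ∎))
    where
    open ≡-Reasoning
    o = test x (ϑ H)

  player : ∀ {i} {I : Set i} {S : Set} → Distribution S → (I → S → Strategy) → Player I
  player {S = S} d s = record
    { Seed           = S
    ; distribution   = Distribution.support d
    ; weights-nonneg = Distribution.nonneg d
    ; weights-sum    = Distribution.sum≡1 d
    ; strategy       = s
    }

  fair : Distribution Bool
  fair = record
    { support = (½ , true) ∷ (½ , false) ∷ []
    ; nonneg  = 0≤½ ∷ 0≤½ ∷ []
    ; sum≡1   = begin
        ½ + (½ + 0#)     ≡⟨ solve 1 (λ h → h :+ (h :+ con 0) := (con 1 :+ (con 1 :+ con 0)) :* h) refl ½ ⟩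
        fromℕ 2 * ½      ≡⟨ ⁻¹-inverseʳ (fromℕ≢0 {2} (s≤s z≤n)) ⟩
        1#               ∎
    }
    where
    open ≡-Reasoning
    open Solver
    ½ = fromℕ 2 ⁻¹
    0≤½ = ⁻¹-nonneg (fromℕ-nonneg 2) (fromℕ≢0 {2} (s≤s z≤n))

  2*𝔼-fair : ∀ f → fromℕ 2 * 𝔼 fair f ≡ f true + f false
  2*𝔼-fair f = begin
    fromℕ 2 * (½ * f true + (½ * f false + 0#))
      ≡⟨ solve 4 (λ t h a b → t :* (h :* a :+ (h :* b :+ con 0)) := (t :* h) :* (a :+ b)) refl (fromℕ 2) ½ (f true) (f false) ⟩
    (fromℕ 2 * ½) * (f true + f false)   ≡⟨ cong (_* _) (⁻¹-inverseʳ (fromℕ≢0 {2} (s≤s z≤n))) ⟩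
    1# * (f true + f false)              ≡⟨ *-identityˡ _ ⟩
    f true + f false                     ∎
    where
    open ≡-Reasoning
    open Solver
    ½ = fromℕ 2 ⁻¹

  extractMax : ∀ x xs → ∃₂ λ m r → x ∷ xs ↭ m ∷ r × All (_≤ m) r
  extractMax x []       = x , [] , ↭-refl , []
  extractMax x (y ∷ ys) with extractMax y ys
  ... | m , r , ↭m , r≤m with total x m
  ...   | inj₁ x≤m = m , x ∷ r , ↭-trans (prep x ↭m) (swap x m ↭-refl) , x≤m ∷ r≤m
  ...   | inj₂ m≤x = x , m ∷ r , prep x ↭m , m≤x ∷ All.map (λ z≤m → ≤-trans z≤m m≤x) r≤m

  -- Everything before `m` fails the test, so play reaches `m`, which then leaves at least `m - θ`.
  constantPlay-bound : ∀ {θ} (0≤θ : 0# ≤ θ) m us vs → All (_≤ θ) us →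
                       m ≤ θ + play (λ _ → finite θ 0≤θ) (us ++ m ∷ vs)
  constantPlay-bound {θ} 0≤θ m [] vs [] = begin
    m                                    ≤⟨ x≤θ+remaining 0≤θ ⟩
    θ + remaining m (finite θ 0≤θ)
      ≤⟨ +-monoʳ-≤ θ (remaining≤payoff (finite θ 0≤θ) m (play-nonneg _ vs)) ⟩
    θ + play (λ _ → finite θ 0≤θ) (m ∷ vs) ∎
    where open ≤-Reasoning
  constantPlay-bound {θ} 0≤θ m (u ∷ us) vs (u≤θ ∷ us≤θ) =
    subst (λ t → m ≤ θ + t) (sym (payoff-fail 0≤θ u≤θ)) (constantPlay-bound 0≤θ m us vs us≤θ)

  module _ (n : ℕ) (2≤n : 2 ℕ.≤ n) where
    L = ⌊log₂ n ⌋
    open Guarantee 𝔽 L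
    1≤L : 1 ℕ.≤ L
    1≤L = ⌊log₂⌋-mono-≤ 2≤n

    -- The player with optimum information.

    informedPlayer : Player Carrier
    informedPlayer = player (iid levels nothing n)
      (λ M ℓs → acceptFirstPass (λ H → thresholdFor M (ℓs (length H))))

    informedPlayer-bound : ∀ M X → length X ≡ n → 0# ≤ M → Any (M ≤_) X →
                           M ≤ fromℕ (12 ℕ.* L) * expectedScore informedPlayer M X
    informedPlayer-bound M X |X|≡n 0≤M any = subst (λ t → M ≤ fromℕ (12 ℕ.* L) * t)
      (𝔼-cong (iid levels nothing n) (λ ℓs → sym (scoreFrom≡play _ [] X
         (λ os → cong (λ H → thresholdFor M (ℓs (length H))) (++-identityʳ os)))))
      (iid-guarantee n X 1≤L (sym |X|≡n)
        (ℕ.≤-trans (ℕ.≤-reflexive |X|≡n) (n≤2^[1+⌊log₂n⌋] n)) 0≤M any)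

    -- The sampling player without information.

    observed : Outcome → Carrier
    -- A default value: under the threshold `∞` of the sampling phase every test fails.
    observed passed     = 0#
    observed (failed x) = x

    h : ℕ
    h = ⌊ n /2⌋

    -- Histories begin with the latest outcome, so dropping all but `h` outcomes leaves exactly the
    -- sample. After it, time and levels are counted from 0 again.
    samplingThreshold : (ℕ → Maybe ℕ) → List Outcome → Threshold
    samplingThreshold ℓs H =
      if does (length H ℕ.<? h) then ∞
      else thresholdFor (maximum (map observed (drop (length H ℕ.∸ h) H))) (ℓs (length H ℕ.∸ h))

    samplingThreshold-sample : ∀ ℓs {H} → length H ℕ.< h → samplingThreshold ℓs H ≡ ∞
    samplingThreshold-sample ℓs {H} |H|<h rewrite dec-true (length H ℕ.<? h) |H|<h = refl

    samplingThreshold-play : ∀ ℓs os {H} → length H ≡ h →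
      samplingThreshold ℓs (os ++ H) ≡ thresholdFor (maximum (map observed H)) (ℓs (length os))
    samplingThreshold-play ℓs os {H} |H|≡h = trans
      (cong (λ b → if b then ∞ else θ (length (os ++ H) ℕ.∸ h))
            (dec-false (length (os ++ H) ℕ.<? h) (ℕ.≤⇒≯ (subst (h ℕ.≤_) (sym |os++H|≡) (ℕ.m≤n+m h (length os))))))
      (trans (cong θ (trans (cong (ℕ._∸ h) |os++H|≡) (ℕ.m+n∸n≡m (length os) h)))
               (cong (λ K → thresholdFor (maximum (map observed K)) (ℓs (length os))) (drop-length-++ os H)))
      where
      θ : ℕ → Threshold
      θ k = thresholdFor (maximum (map observed (drop k (os ++ H)))) (ℓs k)
      |os++H|≡ : length (os ++ H) ≡ length os ℕ.+ h
      |os++H|≡ = trans (length-++ os) (cong (length os ℕ.+_) |H|≡h)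

    -- With threshold `∞` nothing is accepted and the values are merely recorded, in reverse.
    score-sample : ∀ ℓs H us vs → length us ℕ.+ length H ℕ.≤ h →
      scoreFrom (acceptFirstPass (samplingThreshold ℓs)) H (us ++ vs) ≡
      scoreFrom (acceptFirstPass (samplingThreshold ℓs)) (map failed us ʳ++ H) vs
    score-sample ℓs H []       vs _   = refl
    score-sample ℓs H (u ∷ us) vs |us|+|H|<h = trans
      (cong (λ θ → payoff θ u (scoreFrom (acceptFirstPass (samplingThreshold ℓs)) (test u θ ∷ H) (us ++ vs)))
            (samplingThreshold-sample ℓs (ℕ.≤-trans (s≤s (ℕ.m≤n+m (length H) (length us))) |us|+|H|<h)))
      (score-sample ℓs (failed u ∷ H) us vs
        (subst (ℕ._≤ h) (sym (ℕ.+-suc (length us) (length H))) |us|+|H|<h))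

    score-sampling : ∀ ℓs us vs {b} → length us ≡ h → b ∈ us → All (_≤ b) us → 0# ≤ b →
      score (acceptFirstPass (samplingThreshold ℓs)) (us ++ vs) ≡ play (thresholdFor b ∘ ℓs) vs
    score-sampling ℓs us vs {b} |us|≡h b∈ us≤b 0≤b = trans
      (score-sample ℓs [] us vs (ℕ.≤-reflexive (trans (ℕ.+-identityʳ (length us)) |us|≡h)))
      (scoreFrom≡play (samplingThreshold ℓs) H vs (λ os →
        trans (samplingThreshold-play ℓs os |H|≡h) (cong (λ M → thresholdFor M (ℓs (length os))) max≡b)))
      where
      H = map failed us ʳ++ []
      |H|≡h : length H ≡ h
      |H|≡h = trans (length-ʳ++ (map failed us))
             (trans (ℕ.+-identityʳ _) (trans (length-map failed us) |us|≡h))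
      observed-H : map observed H ≡ us ʳ++ []
      observed-H = trans (map-ʳ++ observed (map failed us))
        (cong (_ʳ++ []) (trans (sym (map-∘ us)) (map-id us)))
      us↭ : us ↭ map observed H
      us↭ = ↭-trans (↭-sym (↭-reverse us)) (↭-reflexive (sym observed-H))
      max≡b : maximum (map observed H) ≡ b
      max≡b = max≈v⁺ (∈-resp-↭ us↭ b∈) (All-resp-↭ us↭ us≤b) 0≤b

    -- Level `2 + L` is the end of the grid, hence the sample maximum itself: the constant threshold
    -- becomes a level sequence and shares the seed type of the other branch.
    constantLevel : Distribution (ℕ → Maybe ℕ)
    constantLevel = return (λ _ → just (2 ℕ.+ L))

    mixture : Bool → Distribution (ℕ → Maybe ℕ)
    mixture b = if b then constantLevel else iid levels nothing (n ℕ.∸ h)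

    samplingPlayer : Player ⊤
    samplingPlayer = player (bind fair mixture) (λ _ ℓs → acceptFirstPass (samplingThreshold ℓs))

    expectedScore-nonneg : ∀ X → 0# ≤ expectedScore samplingPlayer tt X
    expectedScore-nonneg X = 𝔼-nonneg (bind fair mixture) (λ ℓs → scoreFrom-nonneg _ [] X)

    -- Write m = b + (m - b). The constant threshold earns at least m - b, the grid branch at least
    -- b / (12 L), and the fair coin doubles the factor.
    samplingPlayer-split : ∀ {m b} us ys zs → length us ≡ h → length (ys ++ m ∷ zs) ≡ n ℕ.∸ h →
      b ∈ us → All (_≤ b) us → All (_≤ b) ys → 0# ≤ b → b ≤ m →
      m ≤ fromℕ (24 ℕ.* L) * expectedScore samplingPlayer tt (us ++ ys ++ m ∷ zs)
    samplingPlayer-split {m} {b} us ys zs |us|≡h |vs|≡ b∈us us≤b ys≤b 0≤b b≤m = begin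
      m
        ≤⟨ constantPlay-bound (Levels.gridPoint-nonneg (spacing-nonneg b) (2 ℕ.+ L)) m ys zs
             (subst (λ t → All (_≤ t) ys) (sym (gridPoint-top 0≤b)) ys≤b) ⟩
      Levels.gridPoint (spacing-nonneg b) (2 ℕ.+ L) + s₁
        ≡⟨ cong (_+ s₁) (gridPoint-top 0≤b) ⟩
      b + s₁
        ≤⟨ +-mono-≤ (iid-guarantee (n ℕ.∸ h) vs 1≤L (sym |vs|≡) |vs|≤ 0≤b
                       -- The grid branch needs an option of size at least `b` after the sample; `m`
                       -- is one.
                       (lose m∈vs b≤m))
                    s₁≤12L*s₁ ⟩
      fromℕ (12 ℕ.* L) * s₂ + fromℕ (12 ℕ.* L) * s₁
        ≡⟨ solve 3 (λ k s t → k :* t :+ k :* s := k :* (s :+ t)) refl (fromℕ (12 ℕ.* L)) s₁ s₂ ⟩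
      fromℕ (12 ℕ.* L) * (s₁ + s₂)
        ≡⟨ cong (fromℕ (12 ℕ.* L) *_) 2E≡ ⟨
      fromℕ (12 ℕ.* L) * (fromℕ 2 * e)
        ≡⟨ solve 3 (λ k t e → k :* (t :* e) := (t :* k) :* e) refl (fromℕ (12 ℕ.* L)) (fromℕ 2) e ⟩
      (fromℕ 2 * fromℕ (12 ℕ.* L)) * e
        ≡⟨ cong (_* e) (fromℕ-* 2 (12 ℕ.* L)) ⟨
      fromℕ (2 ℕ.* (12 ℕ.* L)) * e
        ≡⟨ cong (λ k → fromℕ k * e) (ℕ.*-assoc 2 12 L) ⟨
      fromℕ (24 ℕ.* L) * e
        ∎
      where
      open ≤-Reasoning
      open Solver
      vs = ys ++ m ∷ zs
      m∈vs : m ∈ vs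
      m∈vs = ∈-insert ys
      f : (ℕ → Maybe ℕ) → Carrier
      f ℓs = score (acceptFirstPass (samplingThreshold ℓs)) (us ++ vs)
      e  = expectedScore samplingPlayer tt (us ++ vs)
      s₁ = play (λ _ → thresholdFor b (just (2 ℕ.+ L))) vs
      s₂ = 𝔼 (iid levels nothing (n ℕ.∸ h)) (λ ℓs → play (thresholdFor b ∘ ℓs) vs)
      s₁≤12L*s₁ : s₁ ≤ fromℕ (12 ℕ.* L) * s₁
      s₁≤12L*s₁ = begin
        s₁                      ≡⟨ *-identityˡ s₁ ⟨
        1# * s₁                 ≡⟨ cong (_* s₁) (+-identityʳ 1#) ⟨
        fromℕ 1 * s₁            ≤⟨ *-monoˡ-≤ (play-nonneg _ vs) (fromℕ-mono-≤ {1} {12 ℕ.* L} (ℕ.*-mono-≤ {1} {12} {1} {L} (s≤s z≤n) 1≤L)) ⟩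
        fromℕ (12 ℕ.* L) * s₁   ∎
      |vs|≤ : length vs ℕ.≤ 2 ℕ.^ (1 ℕ.+ L)
      |vs|≤ = ℕ.≤-trans (ℕ.≤-reflexive |vs|≡) (ℕ.≤-trans (ℕ.m∸n≤m n h) (n≤2^[1+⌊log₂n⌋] n))
      2E≡ : fromℕ 2 * e ≡ s₁ + s₂
      2E≡ = trans (cong (fromℕ 2 *_) (𝔼-bind fair mixture f))
        (trans (2*𝔼-fair (λ c → 𝔼 (mixture c) f))
          (cong₂ _+_
            (trans (𝔼-return (λ _ → just (2 ℕ.+ L)) f) (score-sampling (λ _ → just (2 ℕ.+ L)) us vs |us|≡h b∈us us≤b 0≤b))
            (𝔼-cong (iid levels nothing (n ℕ.∸ h)) (λ ℓs → score-sampling ℓs us vs |us|≡h b∈us us≤b 0≤b))))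

    samplingPlayer-bound : ∀ {m b r q} → length q ≡ n → q ↭ m ∷ b ∷ r → All (_≤ b) r → 0# ≤ b → b ≤ m →
      b ∈ take h q → m ∈ drop h q → m ≤ fromℕ (24 ℕ.* L) * expectedScore samplingPlayer tt q
    samplingPlayer-bound {m} {b} {r} {q} |q|≡n q↭ r≤b 0≤b b≤m b∈ m∈ with ∈-∃++ m∈
    ... | ys , zs , drop≡ = subst (λ t → m ≤ fromℕ (24 ℕ.* L) * expectedScore samplingPlayer tt t) q≡
      (samplingPlayer-split (take h q) ys zs |take|
        (trans (cong length (sym drop≡)) (trans (length-drop h q) (cong (ℕ._∸ h) |q|≡n)))
        b∈
        (All.++⁻ˡ (take h q) (All.++⁻ˡ (take h q ++ ys) others≤b))
        (All.++⁻ʳ (take h q) (All.++⁻ˡ (take h q ++ ys) others≤b))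
        0≤b b≤m)
      where
      |take| : length (take h q) ≡ h
      |take| = trans (length-take h q) (ℕ.m≤n⇒m⊓n≡m (subst (h ℕ.≤_) (sym |q|≡n) (ℕ.⌊n/2⌋≤n n)))
      q≡ : take h q ++ ys ++ m ∷ zs ≡ q
      q≡ = trans (cong (take h q ++_) (sym drop≡)) (take++drop≡id h q)
      -- Deleting `m` from the arrival order leaves a rearrangement of `b ∷ r`, so every other entry
      -- is at most `b`.
      others↭ : (take h q ++ ys) ++ zs ↭ b ∷ r
      others↭ = drop-mid (take h q ++ ys) []
        (↭-trans (↭-reflexive (trans (++-assoc (take h q) ys (m ∷ zs)) q≡)) q↭)
      others≤b : All (_≤ b) ((take h q ++ ys) ++ zs)
      others≤b = All-resp-↭ (↭-sym others↭) (≤-refl ∷ r≤b)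

    -- Competitive ratios of the two players.

    α : Carrier
    -- 96 = 4 · 24: the factor 24 L holds for good permutations, and 4 accounts for their frequency
    -- of at least 1/4. The informed player already achieves 12 L.
    α = fromℕ (96 ℕ.* L)

    α≢0 : α ≢ 0#
    α≢0 = fromℕ≢0 (ℕ.*-mono-≤ {1} {96} {1} {L} (s≤s z≤n) 1≤L)

    informedPlayer-competitive : ArbitraryOrderCompetitive optimumInformation n α informedPlayer
    informedPlayer-competitive a |a|≡n 0≤a X X↭a =
      x≤z*y⇒z⁻¹*x≤y (fromℕ-nonneg (96 ℕ.* L)) α≢0 (≤-trans
        (informedPlayer-bound M X (trans (↭-length X↭a) |a|≡n) (⊥≤max 0# a) (M≤X a |a|≡n 0≤a X↭a))
        (*-monoˡ-≤ e-nonneg (fromℕ-mono-≤ (ℕ.*-monoˡ-≤ L (ℕ.m≤m+n 12 84)))))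
      where
      M = maximum a
      e-nonneg = 𝔼-nonneg (iid levels nothing n) (λ ℓs → scoreFrom-nonneg _ [] X)
      M≤X : ∀ a → length a ≡ n → All (0# ≤_) a → X ↭ a → Any (maximum a ≤_) X
      M≤X []       0≡n _ _ = contradiction (subst (2 ℕ.≤_) (sym 0≡n) 2≤n) λ ()
      M≤X (x ∷ xs) _ 0≤a X↭ with extractMax x xs
      ... | m , r , ↭m , r≤m = lose (∈-resp-↭ (↭-sym X↭) (∈-resp-↭ (↭-sym ↭m) (here refl)))
        -- The default `0#` of `maximum` must also lie below `m`; nonnegativity provides this.
        (max≤v⁺ (All.head (All-resp-↭ ↭m 0≤a)) (All-resp-↭ (↭-sym ↭m) (≤-refl ∷ r≤m)))

    samplingPlayer-competitive : RandomOrderCompetitive noInformation n α samplingPlayer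
    samplingPlayer-competitive []           0≡n = contradiction (subst (2 ℕ.≤_) (sym 0≡n) 2≤n) λ ()
    samplingPlayer-competitive a@(x ∷ xs) |a|≡n 0≤a with extractMax x xs
    ... | m , [] , ↭m , _ = contradiction (subst (2 ℕ.≤_) (trans (sym |a|≡n) (↭-length ↭m)) 2≤n) λ { (s≤s ()) }
    ... | m , y ∷ ys , ↭m , r≤m with extractMax y ys
    ...   | b , r , ↭b , r≤b =
      -- Clearing both inverses reduces the claim to `bound`, an inequality between sums over
      -- permutations.
      z*x≤y⇒x≤z⁻¹*y (fromℕ-nonneg (length (permutations a))) (fromℕ≢0 (∈-length (∈-permutations a)))
        (subst (_≤ sumPermutations f a)
          (solve 3 (λ i N m → i :* (N :* m) := N :* (i :* m)) refl (α ⁻¹) N M)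
          (x≤z*y⇒z⁻¹*x≤y (fromℕ-nonneg (96 ℕ.* L)) α≢0 bound))
      where
      open Solver
      f : List Carrier → Carrier
      f = expectedScore samplingPlayer tt
      N = fromℕ (length (permutations a))
      M = maximum a
      a↭ : a ↭ m ∷ b ∷ r
      a↭ = ↭-trans ↭m (prep m ↭b)
      0≤abr : All (0# ≤_) (m ∷ b ∷ r)
      0≤abr = All-resp-↭ a↭ 0≤a
      b≤m : b ≤ m
      b≤m = All.head (All-resp-↭ ↭b r≤m)
      M≡m : M ≡ m
      M≡m = max≈v⁺ (∈-resp-↭ (↭-sym a↭) (here refl))
        (All-resp-↭ (↭-sym a↭) (≤-refl ∷ b≤m ∷ All.map (λ z≤b → ≤-trans z≤b b≤m) r≤b)) (All.head 0≤abr)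
      n≡ : n ≡ suc (suc (length r))
      n≡ = trans (sym |a|≡n) (↭-length a↭)
      N≡ : N ≡ fromℕ (length (permutations (m ∷ b ∷ r)))
      N≡ = trans (sym (sum-const-1 (permutations a)))
          (trans (sumPermutations-resp-↭ (λ _ → 1#) a↭) (sum-const-1 (permutations (m ∷ b ∷ r))))
      -- Scaled so that its value on each good permutation is at least `m`, as `average-splitPair`
      -- demands.
      g : List Carrier → Carrier
      g q = fromℕ (24 ℕ.* L) * f q
      bound : N * M ≤ α * sumPermutations f a
      bound = begin
        N * M   ≡⟨ cong₂ _*_ N≡ M≡m ⟩
        fromℕ (length (permutations (m ∷ b ∷ r))) * m
          ≤⟨ average-splitPair {f = g} 4 h m b r
               (λ q → *-nonneg (fromℕ-nonneg (24 ℕ.* L)) (expectedScore-nonneg q))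
               (All.head 0≤abr)
               (subst (λ k → ⌊ k /2⌋ ℕ.≤ suc (length r)) (sym n≡) (ℕ.s≤s⁻¹ (ℕ.⌊n/2⌋<n (suc (length r)))))
               (subst (λ k → suc (suc (length r)) ℕ.* suc (length r) ℕ.≤ 4 ℕ.* (⌊ k /2⌋ ℕ.* (suc (suc (length r)) ℕ.∸ ⌊ k /2⌋))) (sym n≡)
                 (n[n-1]≤4⌊n/2⌋⌈n/2⌉ (suc (length r))))
               (λ q q↭ → samplingPlayer-bound (trans (↭-length q↭) (sym n≡)) q↭ r≤b (All.head (All.tail 0≤abr)) b≤m) ⟩
        fromℕ 4 * sumPermutations g (m ∷ b ∷ r)
          ≡⟨ cong (fromℕ 4 *_) (trans (sum-*ˡ _ f (permutations (m ∷ b ∷ r)))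
                                        (cong (fromℕ (24 ℕ.* L) *_) (sym (sumPermutations-resp-↭ f a↭)))) ⟩
        fromℕ 4 * (fromℕ (24 ℕ.* L) * sumPermutations f a)
          ≡⟨ *-assoc (fromℕ 4) (fromℕ (24 ℕ.* L)) _ ⟨
        (fromℕ 4 * fromℕ (24 ℕ.* L)) * sumPermutations f a
          ≡⟨ cong (_* sumPermutations f a) (trans (cong fromℕ (ℕ.*-assoc 4 24 L)) (fromℕ-* 4 (24 ℕ.* L))) ⟨
        α * sumPermutations f a ∎
        where open ≤-Reasoning

open import Data.Nat.Base using (_≤_; _<_; _*_)

theorem3 : ∀ {c ℓ} →
  Σ ℕ λ C → 0 < C ×
    ((𝔽 : OrderedField c ℓ) (n : ℕ) → 2 ≤ n →
      let open PenTesting 𝔽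
          α = OrderedField.fromℕ 𝔽 (C * ⌊log₂ n ⌋)
      in  (∃ λ p → RandomOrderCompetitive noInformation n α p)
        × (∃ λ p → ArbitraryOrderCompetitive optimumInformation n α p))
-- The constant is fixed before the field and `n`, hence universal.
theorem3 = 96 , s≤s z≤n , λ 𝔽 n 2≤n →
  let open Players 𝔽
  in  (samplingPlayer n 2≤n , samplingPlayer-competitive n 2≤n)
    , (informedPlayer n 2≤n , informedPlayer-competitive n 2≤n)
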